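{- $\mathrm{Greedy}$ takes $O(n\log k)$ time on $k$-decomposable sequences (with preprocessing). That is: there is an absolute constant $C>0$ such that for all integers $n\ge 1$ and $k\ge 2$ and every $k$-decomposable permutation of $[n]$ with associated point set $X$, the set $G$ of points marked by $\mathrm{Greedy}$ on $X$ satisfies $|X\cup G|\le C\, n\log k$.
   Context: Let $[n]=\{1,\dots,n\}$. A permutation $(p_1,\dots,p_n)$ of $[n]$ (a sequence of keys accessed in a binary search tree, $p_i$ at time $i$) is represented by the planar point set $X=\{(p_i,i): i\in[n]\}$; the first coordinate is written $a.x$ (key) and the second $a.y$ (time). For points $a,b$ not on a common horizontal or vertical line, $\Box(a,b)$ is the closed axis-parallel rectangle with opposite corners $a,b$; it is arborally satisfied with respect to a point set $P$ if $P\setminus\{a,b\}$ contains a point of $\Box(a,b)$. $\mathrm{Greedy}$ processes the times $t=1,\dots,n$ in order. At time $t$, let $p$ be the point of $X$ with $p.y=t$, and let $P_{<t}$ be the set of all points of $X$ and all points marked so far that have $y$-coordinate $<t$. For every $a\in P_{<t}$ with $a.x\ne p.x$ such that $\Box(p,a)$ is not arborally satisfied with respect to $P_{<t}\cup\{p\}$, $\mathrm{Greedy}$ marks the point $(a.x,t)$ (all these rectangles are considered simultaneously). $G$ is the set of all marked points. In the geometric model of binary search trees (with the standard sequence-independent preprocessing step of inserting all keys into a split tree) the running time of $\mathrm{Greedy}$ is, up to constant factors, the number $|X\cup G|$ of points. A block of the permutation is a set of consecutive times $\{i,i+1,\dots,j\}$ such that $\{p_i,\dots,p_j\}$ is a set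 of consecutive integers. A decomposition tree is a rooted tree whose nodes are blocks, whose root is $[n]$, whose leaves are singleton blocks, and in which the children of every internal node are disjoint blocks partitioning it. The permutation is $k$-decomposable if it has a decomposition tree in which every internal node has at most $k$ children. -}

module Defs where

open import Data.Fin using (Fin; toℕ; _≤_)
open import Data.Fin.Permutation using (Permutation′; _⟨$⟩ʳ_)
open import Data.Fin.Properties using (any?; _≟_; _≤?_)
open import Data.List using (List; length; filter; allFin; cartesianProductWith)
open import Data.Nat as ℕ using (ℕ; zero; suc; _^_)
open import Data.Product using (_×_; _,_; ∃; ∃-syntax; uncurry)
open import Data.Sum using (_⊎_)
open import Function using (_⇔_)
open import Level using (0ℓ)
open import Relation.Binary.PropositionalEquality using (_≡_; _≢_; cong; cong₂)
open import Relation.Nullary using (¬_; Dec; ¬?; _×-dec_; _⊎-dec_)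
open import Relation.Nullary.Decidable using (map′)
open import Relation.Unary using (Pred; Decidable; _∈_; _∪_; _∩_; ∅; ｛_｝)
open import Relation.Unary.Properties using (_∪?_; _∩?_; ∅?)

-- Keys and times are numbered from 0: [n] is represented by Fin n.
record Point (n : ℕ) : Set where
  constructor pt
  field
    x : Fin n
    y : Fin n

open Point public

PointSet : ℕ → Set₁
PointSet n = Pred (Point n) 0ℓ

_≟ₚ_ : ∀ {n} (a b : Point n) → Dec (a ≡ b)
pt i s ≟ₚ pt j t =
  map′ (uncurry (cong₂ pt)) (λ eq → cong x eq , cong y eq) (i ≟ j ×-dec s ≟ t)

anyPoint? : ∀ {n} {P : PointSet n} → Decidable P → Dec (∃ P)
anyPoint? P? =
  map′ (λ { (i , j , h) → pt i j , h }) (λ { (pt i j , h) → i , j , h })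
       (any? λ i → any? λ j → P? (pt i j))

grid : ∀ n → List (Point n)
grid n = cartesianProductWith pt (allFin n) (allFin n)

-- grid n lists every point exactly once, so this is the cardinality of P.
card : ∀ {n} {P : PointSet n} → Decidable P → ℕ
card {n} P? = length (filter P? (grid n))

module _ {n : ℕ} where

  Between : Fin n → Fin n → Fin n → Set
  Between i j l = (i ≤ l × l ≤ j) ⊎ (j ≤ l × l ≤ i)

  Between? : ∀ i j → Decidable (Between i j)
  Between? i j l = (i ≤? l ×-dec l ≤? j) ⊎-dec (j ≤? l ×-dec l ≤? i)

  □ : Point n → Point n → PointSet n
  □ a b c = Between (a .x) (b .x) (c .x) × Between (a .y) (b .y) (c .y)

  □? : ∀ a b → Decidable (□ a b)
  □? a b c = Between? (a .x) (b .x) (c .x) ×-dec Between? (a .y) (b .y) (c .y)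

  Satisfied : PointSet n → Point n → Point n → Set
  Satisfied P a b = ∃[ c ] c ∈ P × c ≢ a × c ≢ b × c ∈ □ a b

  Satisfied? : ∀ {P} → Decidable P → ∀ a b → Dec (Satisfied P a b)
  Satisfied? P? a b =
    anyPoint? λ c → P? c ×-dec ¬? (c ≟ₚ a) ×-dec ¬? (c ≟ₚ b) ×-dec □? a b c

  -- The points marked when p is accessed and P is the set of all earlier points.
  Marks : PointSet n → Point n → PointSet n
  Marks P p q =
    ∃[ a ] a ∈ P × a .x ≢ p .x × ¬ Satisfied (P ∪ ｛ p ｝) p a × q ≡ pt (a .x) (p .y)

  Marks? : ∀ {P} → Decidable P → ∀ p → Decidable (Marks P p)
  Marks? P? p q =
    anyPoint? λ a → P? a ×-dec ¬? (a .x ≟ p .x)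
      ×-dec ¬? (Satisfied? (P? ∪? (p ≟ₚ_)) p a) ×-dec (q ≟ₚ pt (a .x) (p .y))

  Earlier : ℕ → PointSet n
  Earlier t a = toℕ (a .y) ℕ.< t

  Earlier? : ∀ t → Decidable (Earlier t)
  Earlier? t a = toℕ (a .y) ℕ.<? t

  module _ (π : Permutation′ n) where

    access : Fin n → Point n
    access i = pt (π ⟨$⟩ʳ i) i

    X : PointSet n
    X a = a ≡ access (a .y)

    X? : Decidable X
    X? a = a ≟ₚ access (a .y)

    -- The points marked by Greedy at times smaller than t.
    MarkedBefore : ℕ → PointSet n
    MarkedBefore zero    = ∅
    MarkedBefore (suc t) = MarkedBefore t ∪ λ q →
      toℕ (q .y) ≡ t × q ∈ Marks ((X ∩ Earlier t) ∪ MarkedBefore t) (access (q .y))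

    MarkedBefore? : ∀ t → Decidable (MarkedBefore t)
    MarkedBefore? zero    = ∅?
    MarkedBefore? (suc t) = MarkedBefore? t ∪? λ q →
      (toℕ (q .y) ℕ.≟ t)
        ×-dec Marks? ((X? ∩? Earlier? t) ∪? MarkedBefore? t) (access (q .y)) q

    G : PointSet n
    G = MarkedBefore n

    G? : Decidable G
    G? = MarkedBefore? n

    record Block : Set where
      field
        first last  : Fin n
        first≤last  : first ≤ last
        lo hi       : Fin n
        consecutive : ∀ v → (lo ≤ v × v ≤ hi)
                          ⇔ (∃[ t ] first ≤ t × t ≤ last × π ⟨$⟩ʳ t ≡ v)

    open Block

    _∈ᵇ_ : Fin n → Block → Set
    t ∈ᵇ B = B .first ≤ t × t ≤ B .last

    -- Decomposition trees with root B in which every internal node has at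
    -- most k children.
    data DecompositionTree (k : ℕ) : Block → Set where
      leaf : ∀ {B} → B .first ≡ B .last → DecompositionTree k B
      node : ∀ {B} (m : ℕ) → m ℕ.≤ k → (child : Fin m → Block) →
             (∀ i j → i ≢ j → ∀ t → ¬ (t ∈ᵇ child i × t ∈ᵇ child j)) →
             (∀ t → t ∈ᵇ B ⇔ (∃[ i ] t ∈ᵇ child i)) →
             (∀ i → DecompositionTree k (child i)) →
             DecompositionTree k B

    Decomposable : ℕ → Set
    Decomposable k = ∃[ B ] (∀ t → t ∈ᵇ B) × DecompositionTree k B

-- The inequality m ≤ a · log₂ k of real numbers (for k ≥ 1), with both sides
-- exponentiated so that it lives in ℕ and no rounding of the logarithm occurs.
infix 4 _≤_·log₂_

_≤_·log₂_ : ℕ → ℕ → ℕ → Set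
m ≤ a ·log₂ k = 2 ^ m ℕ.≤ k ^ a

{-# OPTIONS --safe #-}
module Submission where

-- Call a touch of key a at time t final if a is never touched again, and
-- outermost if no key touched at t lies beyond a as seen from the accessed key.
-- There are O(n) of these.  For any other touch take the smallest block B of the
-- tree with a and t in different children, say a in child j and t in child i.
--
-- * t is the first time of child i.  From then on the nearest key seen earlier
--   on each side of the keys of child i shields everything beyond it, so a later
--   touch outside child i is outermost.
-- * a is the least or the greatest key of child j touched at t.  Since child j is
--   over, any key between two others touched at t is hidden from all later
--   accesses, so its touch is final.
--
-- It remains to count the pairs (i , j) such that child j is touched at the first
-- time of child i.  For B with m ≤ 2^L children this is O(m L): rank the children
-- by key, and split the pairs by the number of halvings after which the ranks
-- agree.  For one such level, call a child visible if it was touched later than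
-- every other child of its group on its left, or on its right.  Accessing one
-- group touches only visible children of the sibling group, and all but the two
-- extreme ones become invisible, while each stage makes only O(1) children of
-- the accessed group visible.  So the number of visible children is a potential
-- showing O(1) amortized touches per stage and level.

open import Defs
open import Data.Fin using (Fin; zero; suc; toℕ; fromℕ<; _<_; _≤_)
open import Data.Fin.Patterns
open import Data.Fin.Permutation using (Permutation′; _⟨$⟩ʳ_; _⟨$⟩ˡ_; inverseˡ; inverseʳ)
open import Data.Fin.Properties using (_≟_; any?; all?; suc-injective; toℕ-injective; toℕ<n; toℕ-fromℕ<)
open import Data.List using (length; filter; allFin; tabulate; map; _++_; cartesianProductWith)
open import Data.List.Properties using (length-++; filter-++; map-tabulate)
open import Data.Maybe using (Maybe; just; nothing)
import Data.Maybe.Properties as Maybe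
open import Data.Nat as ℕ using (ℕ; zero; suc; _+_; _*_; _^_; _>_; _≥_; z≤n; s≤s; ⌊_/2⌋)
open import Data.Nat.Induction using (<-wellFounded)
import Data.Nat.Properties as ℕₚ
open import Data.Nat.Solver using (module +-*-Solver)
open import Data.Product using (_×_; _,_; ∃; ∃-syntax; proj₁; proj₂)
open import Data.Sum using (_⊎_; inj₁; inj₂; [_,_]′)
open import Function using (_∘_; _⇔_; const; Equivalence)
open import Induction.WellFounded using (Acc; acc)
open import Relation.Binary using (tri<; tri≈; tri>)
open import Relation.Binary.PropositionalEquality
open import Relation.Nullary using (¬_; Dec; yes; no; contradiction; ¬?; _×-dec_; _⊎-dec_; _→-dec_)
open import Relation.Unary using (Decidable; _∈_; _∪_; _∩_; ｛_｝)
open import Relation.Unary.Properties using (_∪?_)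
open import Algebra.Properties.Semiring.Sum ℕₚ.+-*-semiring
  using (sum; sum-syntax; ∑-distrib-+; ∑-comm; sum-cong-≗; *-distribˡ-sum; *-distribʳ-sum)
open +-*-Solver using (solve; _:+_; _:*_; _:=_; con)

-- Finite sums and counting

ind : ∀ {P : Set} → Dec P → ℕ
ind (yes _) = 1
ind (no _)  = 0

ind-mono : ∀ {P Q : Set} (P? : Dec P) (Q? : Dec Q) → (P → Q) → ind P? ℕ.≤ ind Q?
ind-mono (no _)  _       _ = z≤n
ind-mono (yes _) (yes _) _ = ℕₚ.≤-refl
ind-mono (yes p) (no ¬q) f = contradiction (f p) ¬q

ind-yes : ∀ {P : Set} (P? : Dec P) → P → 1 ℕ.≤ ind P?
ind-yes (yes _) _ = ℕₚ.≤-refl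
ind-yes (no ¬p) p = contradiction p ¬p

ind-no : ∀ {P : Set} (P? : Dec P) → ¬ P → ind P? ≡ 0
ind-no (yes p) ¬p = contradiction p ¬p
ind-no (no _)  _  = refl

ind≤1 : ∀ {P : Set} (P? : Dec P) → ind P? ℕ.≤ 1
ind≤1 (yes _) = ℕₚ.≤-refl
ind≤1 (no _)  = z≤n

ind-⊎ : ∀ {P Q R : Set} (P? : Dec P) (Q? : Dec Q) (R? : Dec R) → (P → Q ⊎ R) →
        ind P? ℕ.≤ ind Q? + ind R?
ind-⊎ (no _)  _  _  _ = z≤n
ind-⊎ (yes p) Q? R? f with f p
... | inj₁ q = ℕₚ.≤-trans (ind-yes Q? q) (ℕₚ.m≤m+n _ _)
... | inj₂ r = ℕₚ.≤-trans (ind-yes R? r) (ℕₚ.m≤n+m _ _)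

sum-mono : ∀ {m} {f g : Fin m → ℕ} → (∀ i → f i ℕ.≤ g i) → sum f ℕ.≤ sum g
sum-mono {zero}  _   = z≤n
sum-mono {suc m} f≤g = ℕₚ.+-mono-≤ (f≤g zero) (sum-mono (f≤g ∘ suc))

sum-mono-< : ∀ {m} {f g : Fin m → ℕ} → (∀ i → f i ℕ.≤ g i) → ∀ i → f i ℕ.< g i → sum f ℕ.< sum g
sum-mono-< f≤g zero    fi<gi = ℕₚ.+-mono-<-≤ fi<gi (sum-mono (f≤g ∘ suc))
sum-mono-< f≤g (suc i) fi<gi = ℕₚ.+-mono-≤-< (f≤g zero) (sum-mono-< (f≤g ∘ suc) i fi<gi)

sum-const : ∀ m x → ∑[ i < m ] x ≡ m * x
sum-const zero    x = refl
sum-const (suc m) x = cong (x +_) (sum-const m x)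

sum-≤-const : ∀ {m} {f : Fin m → ℕ} x → (∀ i → f i ℕ.≤ x) → sum f ℕ.≤ m * x
sum-≤-const {m} x f≤x = ℕₚ.≤-trans (sum-mono f≤x) (ℕₚ.≤-reflexive (sum-const m x))

sum-zero : ∀ {m} {f : Fin m → ℕ} → (∀ i → f i ≡ 0) → sum f ≡ 0
sum-zero {zero}  _   = refl
sum-zero {suc m} f≡0 = cong₂ _+_ (f≡0 zero) (sum-zero (f≡0 ∘ suc))

term≤sum : ∀ {m} (f : Fin m → ℕ) i → f i ℕ.≤ sum f
term≤sum f zero    = ℕₚ.m≤m+n _ _
term≤sum f (suc i) = ℕₚ.≤-trans (term≤sum (f ∘ suc) i) (ℕₚ.m≤n+m _ _)

sum-single : ∀ {m} (f : Fin m → ℕ) i → (∀ j → j ≢ i → f j ≡ 0) → sum f ℕ.≤ f i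
sum-single f zero    f≡0 =
  ℕₚ.≤-reflexive (trans (cong (f zero +_) (sum-zero λ j → f≡0 (suc j) λ ())) (ℕₚ.+-identityʳ _))
sum-single f (suc i) f≡0 rewrite f≡0 zero (λ ()) =
  sum-single (f ∘ suc) i λ j j≢i → f≡0 (suc j) λ { refl → j≢i refl }

ind≤sum : ∀ {m} {P : Set} {Q : Fin m → Set} (P? : Dec P) (Q? : Decidable Q) → (P → ∃ Q) →
          ind P? ℕ.≤ ∑[ i < m ] ind (Q? i)
ind≤sum (no _)  _  _ = z≤n
ind≤sum (yes p) Q? f with f p
... | i , q = ℕₚ.≤-trans (ind-yes (Q? i) q) (term≤sum (λ i → ind (Q? i)) i)

count≤1 : ∀ {m} {P : Fin m → Set} (P? : Decidable P) → (∀ i j → P i → P j → i ≡ j) →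
          ∑[ i < m ] ind (P? i) ℕ.≤ 1
count≤1 {zero}  P? uniq = z≤n
count≤1 {suc m} P? uniq with P? zero
... | no _  = count≤1 (P? ∘ suc) λ i j p q → suc-injective (uniq _ _ p q)
... | yes p = ℕₚ.≤-reflexive (cong suc (sum-zero λ i → ind-no (P? (suc i)) λ q → 0≢1 (uniq _ _ p q)))
  where
  0≢1 : ∀ {i : Fin m} → zero ≢ suc i
  0≢1 ()

-- Every counted index is charged to one of `k` colours, and no colour is charged twice. Since `R`
-- carries no decision procedure, the double count uses the decidable relation that `c` is the
-- colour chosen by `cover`.
count≤colours : ∀ {m k} {P : Fin m → Set} (P? : Decidable P) (R : Fin k → Fin m → Set) →
                (∀ j → P j → ∃[ c ] R c j) → (∀ c i j → R c i → R c j → i ≡ j) →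
                ∑[ j < m ] ind (P? j) ℕ.≤ k
count≤colours {m} {k} {P} P? R cover uniq = begin
  ∑[ j < m ] ind (P? j)                   ≤⟨ sum-mono (λ j → ind≤sum (P? j) (has? j) (coloured j)) ⟩
  ∑[ j < m ] ∑[ c < k ] ind (has? j c)    ≡⟨ ∑-comm (λ j c → ind (has? j c)) ⟩
  ∑[ c < k ] ∑[ j < m ] ind (has? j c)    ≤⟨ sum-≤-const 1 (λ c → count≤1 (λ j → has? j c)
                                               λ i j p q → uniq c i j (sound i p) (sound j q)) ⟩
  k * 1                                   ≡⟨ ℕₚ.*-identityʳ k ⟩
  k                                       ∎
  where
  open ℕₚ.≤-Reasoning
  colour : ∀ j → Dec (P j) → Maybe (Fin k)
  colour j (yes p) = just (proj₁ (cover j p))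
  colour j (no _)  = nothing
  has? : ∀ j c → Dec (colour j (P? j) ≡ just c)
  has? j c = Maybe.≡-dec _≟_ _ _
  coloured : ∀ j → P j → ∃[ c ] colour j (P? j) ≡ just c
  coloured j p with P? j
  ... | yes p′ = _ , refl
  ... | no ¬p  = contradiction p ¬p
  sound : ∀ j {c} → colour j (P? j) ≡ just c → R c j
  sound j eq with P? j
  sound j refl | yes p = proj₂ (cover j p)

length-filter-tabulate : ∀ {A : Set} {P : A → Set} (P? : Decidable P) {m} (f : Fin m → A) →
                         length (filter P? (tabulate f)) ≡ ∑[ i < m ] ind (P? (f i))
length-filter-tabulate P? {zero}  f = refl
length-filter-tabulate P? {suc m} f with P? (f zero)
... | yes _ = cong suc (length-filter-tabulate P? (f ∘ suc))
... | no _  = length-filter-tabulate P? (f ∘ suc)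

card≡sum : ∀ {n} {P : PointSet n} (P? : Decidable P) → card P? ≡ ∑[ a < n ] ∑[ t < n ] ind (P? (pt a t))
card≡sum {n} P? = rows (λ a → a)
  where
  open ≡-Reasoning
  rows : ∀ {m} (f : Fin m → Fin n) → length (filter P? (cartesianProductWith pt (tabulate f) (allFin n)))
                                     ≡ ∑[ a < m ] ∑[ t < n ] ind (P? (pt (f a) t))
  rows {zero}  f = refl
  rows {suc m} f = begin
    length (filter P? (map (pt (f zero)) (allFin n) ++ rest))
      ≡⟨ cong length (filter-++ P? (map (pt (f zero)) (allFin n)) rest) ⟩
    length (filter P? (map (pt (f zero)) (allFin n)) ++ filter P? rest)
      ≡⟨ length-++ (filter P? (map (pt (f zero)) (allFin n))) ⟩
    length (filter P? (map (pt (f zero)) (allFin n))) + length (filter P? rest)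
      ≡⟨ cong₂ _+_ (trans (cong (length ∘ filter P?) (map-tabulate (λ t → t) (pt (f zero))))
                          (length-filter-tabulate P? (pt (f zero))))
                   (rows (f ∘ suc)) ⟩
    ∑[ t < n ] ind (P? (pt (f zero) t)) + ∑[ a < m ] ∑[ t < n ] ind (P? (pt (f (suc a)) t)) ∎
    where rest = cartesianProductWith pt (tabulate (f ∘ suc)) (allFin n)

-- A fibre of halving has only two elements, so one is left once `c` is excluded. This makes the
-- sibling of a group unique.
⌊/2⌋-pigeonhole : ∀ a b c → ⌊ a /2⌋ ≡ ⌊ c /2⌋ → ⌊ b /2⌋ ≡ ⌊ c /2⌋ → a ≢ c → b ≢ c → a ≡ b
⌊/2⌋-pigeonhole 0 0 _ _ _ _ _ = refl
⌊/2⌋-pigeonhole 1 1 _ _ _ _ _ = refl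
⌊/2⌋-pigeonhole 0 1 0 _ _ a≢c _ = contradiction refl a≢c
⌊/2⌋-pigeonhole 0 1 1 _ _ _ b≢c = contradiction refl b≢c
⌊/2⌋-pigeonhole 1 0 0 _ _ _ b≢c = contradiction refl b≢c
⌊/2⌋-pigeonhole 1 0 1 _ _ a≢c _ = contradiction refl a≢c
⌊/2⌋-pigeonhole 0 (suc (suc _)) (suc (suc _)) ()
⌊/2⌋-pigeonhole 1 (suc (suc _)) 0 _ ()
⌊/2⌋-pigeonhole 1 (suc (suc _)) 1 _ ()
⌊/2⌋-pigeonhole 1 (suc (suc _)) (suc (suc _)) ()
⌊/2⌋-pigeonhole (suc (suc a)) (suc (suc b)) (suc (suc c)) eq eq′ a≢c b≢c =
  cong (2 +_) (⌊/2⌋-pigeonhole a b c (ℕₚ.suc-injective eq) (ℕₚ.suc-injective eq′)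
    (a≢c ∘ cong (2 +_)) (b≢c ∘ cong (2 +_)))

sum-delta : ∀ {m} (f : Fin m → ℕ) i → ∑[ j < m ] (ind (j ≟ i) * f j) ≡ f i
sum-delta f i = ℕₚ.≤-antisym
  (ℕₚ.≤-trans (sum-single term i λ j j≢i → cong (_* f j) (ind-no (j ≟ i) j≢i)) (ℕₚ.≤-reflexive term-i))
  (ℕₚ.≤-trans (ℕₚ.≤-reflexive (sym term-i)) (term≤sum term i))
  where
  term : Fin _ → ℕ
  term j = ind (j ≟ i) * f j
  term-i : term i ≡ f i
  term-i with i ≟ i
  ... | yes _  = ℕₚ.*-identityˡ (f i)
  ... | no i≢i = contradiction refl i≢i

⌊/2⌋-< : ∀ a b → a ℕ.< 2 * b → ⌊ a /2⌋ ℕ.< b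
⌊/2⌋-< a b a<2b = ℕₚ.≰⇒> λ b≤a/2 → ℕₚ.<⇒≱ a<2b (begin
  2 * b                    ≡⟨ cong (b +_) (ℕₚ.+-identityʳ b) ⟩
  b + b                    ≤⟨ ℕₚ.+-mono-≤ b≤a/2 (ℕₚ.≤-trans b≤a/2 (ℕₚ.⌊n/2⌋≤⌈n/2⌉ a)) ⟩
  ⌊ a /2⌋ + ℕ.⌈ a /2⌉      ≡⟨ ℕₚ.⌊n/2⌋+⌈n/2⌉≡n a ⟩
  a                        ∎)
  where open ℕₚ.≤-Reasoning

-- `L` is the binary logarithm rounded up, found by induction on `k`. For `k ≥ 2` rounding up at
-- most doubles the logarithm, hence the square.
log₂-approx : ∀ k → k ≥ 2 → ∃[ L ] k ℕ.≤ 2 ^ L × 2 ^ L ℕ.≤ k ^ 2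
log₂-approx (suc zero) (s≤s ())
log₂-approx (suc (suc zero)) _ = 1 , ℕₚ.≤-refl , ℕₚ.m≤m+n 2 2
log₂-approx (suc (suc (suc k))) _ with log₂-approx (suc (suc k)) (s≤s (s≤s z≤n))
... | L , k≤2^L , 2^L≤k² with 3 + k ℕ.≤? 2 ^ L
... | yes k<2^L = L , k<2^L , ℕₚ.≤-trans 2^L≤k² (ℕₚ.^-monoˡ-≤ 2 (ℕₚ.n≤1+n (2 + k)))
-- Here `2 ^ L` is exactly `2 + k`. One more doubling makes room for `3 + k`, and both factors `2`
-- and `2 ^ L` are at most `3 + k`.
... | no k≮2^L  = suc L ,
    ℕₚ.+-mono-≤ (ℕₚ.m^n>0 2 L) (ℕₚ.≤-trans k≤2^L (ℕₚ.m≤m+n (2 ^ L) 0)) ,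
    ℕₚ.*-mono-≤ (s≤s (s≤s (z≤n {suc k})))
      (ℕₚ.≤-trans (ℕₚ.≰⇒≥ k≮2^L) (ℕₚ.≤-reflexive (sym (ℕₚ.*-identityʳ (3 + k)))))

-- The execution of Greedy

module Execution {n : ℕ} (π : Permutation′ n) where

  Touch : Fin n → Fin n → Set
  Touch a t = pt a t ∈ X π ∪ G π

  Touch? : ∀ a t → Dec (Touch a t)
  Touch? a t = (X? π ∪? G? π) (pt a t)

  Before : ℕ → PointSet n
  Before t = (X π ∩ Earlier t) ∪ MarkedBefore π t

  marked-early : ∀ t {q} → q ∈ MarkedBefore π t → toℕ (q .y) ℕ.< t
  marked-early (suc t) (inj₁ q∈)        = ℕₚ.m<n⇒m<1+n (marked-early t q∈)
  marked-early (suc t) (inj₂ (refl , _)) = ℕₚ.n<1+n t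

  marked-mono : ∀ {t u q} → t ℕ.≤′ u → q ∈ MarkedBefore π t → q ∈ MarkedBefore π u
  marked-mono ℕ.≤′-refl       q∈ = q∈
  marked-mono (ℕ.≤′-step t≤u) q∈ = inj₁ (marked-mono t≤u q∈)

  -- Each stage adds only points at its own time, so an early point of a later stage was already
  -- marked by its own stage.
  marked-restrict : ∀ u {t q} → q ∈ MarkedBefore π u → toℕ (q .y) ℕ.< t → q ∈ MarkedBefore π t
  marked-restrict (suc u) (inj₁ q∈)          y<t = marked-restrict u q∈ y<t
  marked-restrict (suc u) (inj₂ m@(refl , _)) y<t = marked-mono (ℕₚ.≤⇒≤′ y<t) (inj₂ m)

  before⇒touch : ∀ {t : Fin n} {q} → q ∈ Before (toℕ t) → Touch (q .x) (q .y) × q .y < t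
  before⇒touch     (inj₁ (q∈X , y<t)) = inj₁ q∈X , y<t
  before⇒touch {t} (inj₂ q∈)          =
    inj₂ (marked-mono (ℕₚ.≤⇒≤′ (ℕₚ.<⇒≤ (toℕ<n t))) q∈) , marked-early (toℕ t) q∈

  touch⇒before : ∀ {a s} {t : Fin n} → Touch a s → s < t → pt a s ∈ Before (toℕ t)
  touch⇒before (inj₁ ∈X) s<t = inj₁ (∈X , s<t)
  touch⇒before (inj₂ ∈G) s<t = inj₂ (marked-restrict n ∈G s<t)

  touch-access : ∀ t → Touch (π ⟨$⟩ʳ t) t
  touch-access t = inj₁ refl

  touch⇒marks : ∀ {a t} → Touch a t → a ≢ π ⟨$⟩ʳ t → pt a t ∈ Marks (Before (toℕ t)) (access π t)
  touch⇒marks         (inj₁ eq) a≢p = contradiction (cong x eq) a≢p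
  touch⇒marks {a} {t} (inj₂ ∈G) a≢p with marked-restrict n {t = suc (toℕ t)} ∈G (ℕₚ.n<1+n _)
  ... | inj₁ q∈       = contradiction (marked-early (toℕ t) q∈) (ℕₚ.<-irrefl refl)
  ... | inj₂ (_ , m)  = m

  marks⇒touch : ∀ {a t} → pt a t ∈ Marks (Before (toℕ t)) (access π t) → Touch a t
  marks⇒touch {a} {t} m = inj₂ (marked-mono (ℕₚ.≤⇒≤′ (toℕ<n t)) (inj₂ (refl , m)))

  -- The unsatisfied rectangle behind the mark has its far corner at `(a , s)`; any further touch
  -- inside it would satisfy it.
  touch-stair : ∀ {a t} → Touch a t → a ≢ π ⟨$⟩ʳ t →
    ∃[ s ] s < t × Touch a s ×
      (∀ w s′ → Between (π ⟨$⟩ʳ t) a w → s ≤ s′ → s′ < t → Touch w s′ → w ≡ a × s′ ≡ s)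
  touch-stair {a} {t} ta a≢p with touch⇒marks ta a≢p
  ... | pt _ s , ∈P , _ , unsat , refl = s , proj₂ (before⇒touch ∈P) , proj₁ (before⇒touch ∈P) , empty
    where
    empty : ∀ w s′ → Between (π ⟨$⟩ʳ t) a w → s ≤ s′ → s′ < t → Touch w s′ → w ≡ a × s′ ≡ s
    empty w s′ btw s≤s′ s′<t tw with (w ≟ a) ×-dec (s′ ≟ s)
    ... | yes eqs = eqs
    ... | no ¬eqs = contradiction
      (pt w s′ , inj₁ (touch⇒before tw s′<t)
               , (λ eq → ℕₚ.<-irrefl (cong (toℕ ∘ y) eq) s′<t)
               , (λ eq → ¬eqs (cong x eq , cong y eq))
               , btw , inj₂ (s≤s′ , ℕₚ.<⇒≤ s′<t))
      unsat

  last-touch : ∀ {a s} {t : Fin n} → Touch a s → s < t →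
    ∃[ u ] u < t × Touch a u × (∀ s′ → u < s′ → s′ < t → ¬ Touch a s′)
  last-touch {a} {s} {t} ts s<t = go ts s<t (<-wellFounded _)
    where
    go : ∀ {s} → Touch a s → s < t → Acc ℕ._<_ (toℕ t ℕ.∸ toℕ s) →
         ∃[ u ] u < t × Touch a u × (∀ s′ → u < s′ → s′ < t → ¬ Touch a s′)
    go {s} ts s<t (acc rec) with any? (λ s′ → (toℕ s ℕ.<? toℕ s′) ×-dec (toℕ s′ ℕ.<? toℕ t) ×-dec Touch? a s′)
    ... | no none                    = s , s<t , ts , λ s′ s<s′ s′<t ts′ → none (s′ , s<s′ , s′<t , ts′)
    ... | yes (s′ , s<s′ , s′<t , ts′) = go ts′ s′<t (rec (ℕₚ.∸-monoʳ-< s<s′ (ℕₚ.<⇒≤ s′<t)))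

  -- The rectangle reaching to the last touch of `a` is unsatisfied: the other keys in its range
  -- were never touched, and the column of `a` holds no later touch before `t`.
  touch-neighbour : ∀ {a s t} → a ≢ π ⟨$⟩ʳ t → Touch a s → s < t →
    (∀ w s′ → Between (π ⟨$⟩ʳ t) a w → w ≢ a → s′ < t → ¬ Touch w s′) → Touch a t
  touch-neighbour {a} {s} {t} a≢p ts s<t none =
    let u , u<t , tu , last = last-touch ts s<t
    in marks⇒touch (pt a u , touch⇒before tu u<t , a≢p , unsat last , refl)
    where
    unsat : ∀ {u} → (∀ s′ → u < s′ → s′ < t → ¬ Touch a s′) →
            ¬ Satisfied (Before (toℕ t) ∪ ｛ access π t ｝) (access π t) (pt a u)
    unsat _ (c , inj₂ eq , c≢p , _) = c≢p (sym eq)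
    unsat last (pt w s′ , inj₁ ∈P , _ , c≢a , bx , by) with before⇒touch ∈P | w ≟ a
    ... | tw , s′<t | no w≢a   = none w s′ bx w≢a s′<t tw
    ... | tw , s′<t | yes refl with by
    ... | inj₁ (t≤s′ , _) = contradiction t≤s′ (ℕₚ.<⇒≱ s′<t)
    ... | inj₂ (u≤s′ , _) = last s′ (ℕₚ.≤∧≢⇒< u≤s′ λ eq → c≢a (cong (pt a) (toℕ-injective (sym eq)))) s′<t tw

-- The three properties of Greedy that the proof uses.
record Process {n : ℕ} (π : Permutation′ n) : Set₁ where
  field
    Touch           : Fin n → Fin n → Set
    Touch?          : ∀ a t → Dec (Touch a t)
    touch-access    : ∀ t → Touch (π ⟨$⟩ʳ t) t
    touch-stair     : ∀ {a t} → Touch a t → a ≢ π ⟨$⟩ʳ t →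
      ∃[ s ] s < t × Touch a s ×
        (∀ w s′ → Between (π ⟨$⟩ʳ t) a w → s ≤ s′ → s′ < t → Touch w s′ → w ≡ a × s′ ≡ s)
    touch-neighbour : ∀ {a s t} → a ≢ π ⟨$⟩ʳ t → Touch a s → s < t →
      (∀ w s′ → Between (π ⟨$⟩ʳ t) a w → w ≢ a → s′ < t → ¬ Touch w s′) → Touch a t

greedy : ∀ {n} (π : Permutation′ n) → Process π
greedy π = record { Execution π }

-- Keys and times of blocks

Keys : ∀ {n} {π : Permutation′ n} → Block π → Fin n → Set
Keys B a = B .lo ≤ a × a ≤ B .hi
  where open Block

Btw : ∀ {n} → Fin n → Fin n → Fin n → Set
Btw u w v = (u < w × w < v) ⊎ (v < w × w < u)

Btw? : ∀ {n} (u w v : Fin n) → Dec (Btw u w v)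
Btw? u w v = ((toℕ u ℕ.<? toℕ w) ×-dec (toℕ w ℕ.<? toℕ v)) ⊎-dec ((toℕ v ℕ.<? toℕ w) ×-dec (toℕ w ℕ.<? toℕ u))

Btw⇒Between : ∀ {n} {u w v : Fin n} → Btw u w v → Between u v w
Btw⇒Between (inj₁ (u<w , w<v)) = inj₁ (ℕₚ.<⇒≤ u<w , ℕₚ.<⇒≤ w<v)
Btw⇒Between (inj₂ (v<w , w<u)) = inj₂ (ℕₚ.<⇒≤ v<w , ℕₚ.<⇒≤ w<u)

Between⇒Btw : ∀ {n} {u w v : Fin n} → w ≢ u → w ≢ v → Between u v w → Btw u w v
Between⇒Btw w≢u w≢v (inj₁ (u≤w , w≤v)) =
  inj₁ (ℕₚ.≤∧≢⇒< u≤w (w≢u ∘ sym ∘ toℕ-injective) , ℕₚ.≤∧≢⇒< w≤v (w≢v ∘ toℕ-injective))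
Between⇒Btw w≢u w≢v (inj₂ (v≤w , w≤u)) =
  inj₂ (ℕₚ.≤∧≢⇒< v≤w (w≢v ∘ sym ∘ toℕ-injective) , ℕₚ.≤∧≢⇒< w≤u (w≢u ∘ toℕ-injective))

Btw-irrefl : ∀ {n} {u w : Fin n} → ¬ Btw u w w
Btw-irrefl (inj₁ (_ , w<w)) = ℕₚ.<-irrefl refl w<w
Btw-irrefl (inj₂ (w<w , _)) = ℕₚ.<-irrefl refl w<w

Btw-trans : ∀ {n} {u w v z : Fin n} → Btw u w v → Btw u v z → Btw u w z
Btw-trans (inj₁ (u<w , w<v)) (inj₁ (_ , v<z))   = inj₁ (u<w , ℕₚ.<-trans w<v v<z)
Btw-trans (inj₁ (u<w , w<v)) (inj₂ (_ , v<u))   = contradiction (ℕₚ.<-trans u<w w<v) (ℕₚ.<-asym v<u)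
Btw-trans (inj₂ (v<w , w<u)) (inj₁ (u<v , _))   = contradiction (ℕₚ.<-trans v<w w<u) (ℕₚ.<-asym u<v)
Btw-trans (inj₂ (v<w , w<u)) (inj₂ (z<v , _))   = inj₂ (ℕₚ.<-trans z<v v<w , w<u)

-- The decreasing quantity in the search for the nearest key in `shielded`.
Btw⇒closer : ∀ {n} {u w v : Fin n} → Btw u w v →
             ℕ.∣ toℕ w - toℕ u ∣ ℕ.< ℕ.∣ toℕ v - toℕ u ∣
Btw⇒closer {u = u} {w} {v} (inj₁ (u<w , w<v))
  rewrite ℕₚ.m≤n⇒∣n-m∣≡n∸m (ℕₚ.<⇒≤ u<w) | ℕₚ.m≤n⇒∣n-m∣≡n∸m (ℕₚ.<⇒≤ (ℕₚ.<-trans u<w w<v))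
  = ℕₚ.∸-monoˡ-< w<v (ℕₚ.<⇒≤ u<w)
Btw⇒closer {u = u} {w} {v} (inj₂ (v<w , w<u))
  rewrite ℕₚ.m≤n⇒∣m-n∣≡n∸m (ℕₚ.<⇒≤ w<u) | ℕₚ.m≤n⇒∣m-n∣≡n∸m (ℕₚ.<⇒≤ (ℕₚ.<-trans v<w w<u))
  = ℕₚ.∸-monoʳ-< v<w (ℕₚ.<⇒≤ w<u)

module Geometry {n : ℕ} (π : Permutation′ n) where

  time : Fin n → Fin n
  time a = π ⟨$⟩ˡ a

  module _ (D : Block π) where
    open Block D

    Keys? : ∀ a → Dec (Keys D a)
    Keys? a = (toℕ lo ℕ.≤? toℕ a) ×-dec (toℕ a ℕ.≤? toℕ hi)

    InTime? : ∀ t → Dec (_∈ᵇ_ π t D)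
    InTime? t = (toℕ first ℕ.≤? toℕ t) ×-dec (toℕ t ℕ.≤? toℕ last)

    first∈ : _∈ᵇ_ π first D
    first∈ = ℕₚ.≤-refl , first≤last

    last∈ : _∈ᵇ_ π last D
    last∈ = first≤last , ℕₚ.≤-refl

  module _ {D : Block π} where
    open Block D

    key⇒time : ∀ {a} → Keys D a → _∈ᵇ_ π (time a) D
    key⇒time a∈ with Equivalence.to (consecutive _) a∈
    ... | t , f≤t , t≤l , refl = subst (λ s → _∈ᵇ_ π s D) (sym (inverseˡ π)) (f≤t , t≤l)

    time⇒key : ∀ {t} → _∈ᵇ_ π t D → Keys D (π ⟨$⟩ʳ t)
    time⇒key (f≤t , t≤l) = Equivalence.from (consecutive _) (_ , f≤t , t≤l , refl)

    -- `Block` has no field `lo ≤ hi`; the inequality follows from the key accessed at the first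
    -- time.
    lo∈ : Keys D lo
    lo∈ = ℕₚ.≤-refl , ℕₚ.≤-trans (proj₁ p∈) (proj₂ p∈)
      where p∈ = time⇒key (first∈ D)

    outside⇒< : ∀ {a} → ¬ Keys D a → a < lo ⊎ hi < a
    outside⇒< {a} a∉ with toℕ lo ℕ.≤? toℕ a
    ... | no lo≰a  = inj₁ (ℕₚ.≰⇒> lo≰a)
    ... | yes lo≤a = inj₂ (ℕₚ.≰⇒> λ a≤hi → a∉ (lo≤a , a≤hi))

    -- An outside key lies below or above the whole key interval of the block, so what it separates
    -- from one key of the block it separates from all of them.
    Btw-sameside : ∀ {u u′ w v} → Keys D u → Keys D u′ → ¬ Keys D w → Btw u w v → Btw u′ w v
    Btw-sameside (lo≤u , u≤hi) (lo≤u′ , u′≤hi) w∉ btw with outside⇒< w∉ | btw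
    ... | inj₁ w<lo | inj₁ (u<w , _)   = contradiction (ℕₚ.<-≤-trans (ℕₚ.<-trans u<w w<lo) lo≤u) (ℕₚ.<-irrefl refl)
    ... | inj₁ w<lo | inj₂ (v<w , _)   = inj₂ (v<w , ℕₚ.<-≤-trans w<lo lo≤u′)
    ... | inj₂ hi<w | inj₁ (_ , w<v)   = inj₁ (ℕₚ.≤-<-trans u′≤hi hi<w , w<v)
    ... | inj₂ hi<w | inj₂ (_ , w<u)   = contradiction (ℕₚ.≤-<-trans u≤hi (ℕₚ.<-trans hi<w w<u)) (ℕₚ.<-irrefl refl)

    -- From outside, the interval is seen from one side, so the nearer of `a` and `c` hides `b`.
    outside-middle : ∀ {u a b c} → ¬ Keys D u → Keys D a → Keys D c → a < b → b < c →
                     Btw u a b ⊎ Btw u c b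
    outside-middle u∉ (lo≤a , _) (_ , c≤hi) a<b b<c with outside⇒< u∉
    ... | inj₁ u<lo = inj₁ (inj₁ (ℕₚ.<-≤-trans u<lo lo≤a , a<b))
    ... | inj₂ hi<u = inj₂ (inj₂ (b<c , ℕₚ.≤-<-trans c≤hi hi<u))

    outside-Btw : ∀ {u w v} → Keys D u → ¬ Keys D w → Btw u w v → ¬ Keys D v
    outside-Btw u∈ w∉ btw v∈ with Btw-sameside u∈ v∈ w∉ btw
    ... | inj₁ (v<w , w<v) = ℕₚ.<-asym v<w w<v
    ... | inj₂ (v<w , w<v) = ℕₚ.<-asym v<w w<v

-- Touches seen from a block: shielded and hidden keys

module Blocks {n : ℕ} {π : Permutation′ n} (𝒢 : Process π) where
  open Process 𝒢
  open Geometry π public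
  open Block

  p : Fin n → Fin n
  p t = π ⟨$⟩ʳ t

  touch-own-time : ∀ a → Touch a (time a)
  touch-own-time a = subst (λ b → Touch b (time a)) (inverseʳ π) (touch-access (time a))

  -- Stairs followed backwards in time can only end at the access of `a`.
  touch⇒accessed : ∀ {a t} → Touch a t → time a ≤ t
  touch⇒accessed {a} {t} ta = go ta (<-wellFounded _)
    where
    go : ∀ {t} → Touch a t → Acc ℕ._<_ (toℕ t) → time a ≤ t
    go {t} ta (acc rec) with a ≟ p t
    ... | yes refl = ℕₚ.≤-reflexive (cong toℕ (inverseˡ π))
    ... | no a≢p with touch-stair ta a≢p
    ... | s , s<t , ts , _ = ℕₚ.≤-trans (go ts (rec s<t)) (ℕₚ.<⇒≤ s<t)

  module _ {D : Block π} where

    untouched-before : ∀ {a s} → Keys D a → s < D .first → ¬ Touch a s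
    untouched-before a∈ s<f ta =
      ℕₚ.<⇒≱ s<f (ℕₚ.≤-trans (proj₁ (key⇒time {D = D} a∈)) (touch⇒accessed ta))

    -- No touch precedes the access of its key, and an access of `a` during `D` would make `a` a key
    -- of `D`.
    foreign⇒earlier : ∀ {a t} → _∈ᵇ_ π t D → Touch a t → ¬ Keys D a → time a < D .first
    foreign⇒earlier {a} {t} (_ , t≤l) ta a∉ = ℕₚ.≰⇒> λ f≤time →
      a∉ (subst (Keys D) (inverseʳ π)
           (time⇒key {D = D} (f≤time , ℕₚ.≤-trans (touch⇒accessed ta) t≤l)))

    -- The keys outside a block that were seen before it: at its first time the
    -- nearest one on each side is touched, and shields all others afterwards.
    shielded : ∀ {t y w} → _∈ᵇ_ π t D → D .first < t → Touch y t →
               ¬ Keys D w → time w < D .first → ¬ Btw (p t) w y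
    shielded {t} {y} {w} t∈ f<t ty w∉ w-early btw = go t∈ f<t ty btw (<-wellFounded _)
      where
      s = D .first
      -- Replace `w` by closer keys until no earlier foreign key lies nearer; the last one is
      -- touched at time `s` by `touch-neighbour`.
      nearest : ∀ {t} w → _∈ᵇ_ π t D → ¬ Keys D w → time w < s → Btw (p t) w y →
                Acc ℕ._<_ ℕ.∣ toℕ w - toℕ (p t) ∣ →
                ∃[ v ] Touch v s × Btw (p t) v y
      nearest {t} w t∈ w∉ w-early btw (acc rec)
        with any? (λ v → ¬? (Keys? D v) ×-dec (toℕ (time v) ℕ.<? toℕ s) ×-dec Btw? (p t) v w)
      ... | yes (v , v∉ , v-early , bv) =
        nearest v t∈ v∉ v-early (Btw-trans bv btw) (rec (Btw⇒closer bv))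
      ... | no none = w , touch-neighbour w≢p (touch-own-time w) w-early quiet , btw
        where
        w≢p : w ≢ p s
        w≢p refl = w∉ (time⇒key {D = D} (first∈ D))
        quiet : ∀ v s′ → Between (p s) w v → v ≢ w → s′ < s → ¬ Touch v s′
        quiet v s′ bv v≢w s′<s tv with Keys? D v
        ... | yes v∈ = untouched-before v∈ s′<s tv
        -- `none` speaks of `p t`, while this touch is seen from `p s`. Both are keys of `D`, so `v`
        -- hides `w` from neither or from both.
        ... | no v∉  = none (v , v∉ , ℕₚ.≤-<-trans (touch⇒accessed tv) s′<s ,
          Btw-sameside {D = D} (time⇒key {D = D} (first∈ D)) (time⇒key {D = D} t∈) v∉
            (Between⇒Btw (λ { refl → v∉ (time⇒key {D = D} (first∈ D)) }) v≢w bv))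
      -- Trace the stair of `y` back to time `u`. If `u` is after `s`, the same situation holds at
      -- `u`; otherwise the stair spans time `s` and its rectangle contains the shield `v`.
      go : ∀ {t} → _∈ᵇ_ π t D → s < t → Touch y t → Btw (p t) w y → Acc ℕ._<_ (toℕ t) → _
      go {t} t∈ s<t ty btw (acc rec)
        with nearest w t∈ w∉ w-early btw (<-wellFounded _) |
             touch-stair ty (λ { refl → outside-Btw {D = D} (time⇒key {D = D} t∈) w∉ btw (time⇒key {D = D} t∈) })
      ... | v , tv , bv | u , u<t , tu , quiet with toℕ s ℕ.<? toℕ u
      ... | yes s<u = go u∈ s<u tu
              (Btw-sameside {D = D} (time⇒key {D = D} t∈) (time⇒key {D = D} u∈) w∉ btw) (rec u<t)
        where u∈ = ℕₚ.<⇒≤ s<u , ℕₚ.<⇒≤ (ℕₚ.<-≤-trans u<t (proj₂ t∈))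
      ... | no s≮u with quiet v s (Btw⇒Between bv) (ℕₚ.≮⇒≥ s≮u) s<t tv
      ... | refl , _ = Btw-irrefl bv

    -- Later accesses lie outside `D` and see `a` or `c` in front of `b`. The stairs of a later
    -- touch of `b` lead back to one that begins at or before `t`, and its rectangle would contain
    -- the nearer of the two touches at `t`.
    middle⇒final : ∀ {t a b c} → D .last < t → Keys D a → Keys D b → Keys D c → a < b → b < c →
                   Touch a t → Touch c t → ∀ u → t < u → ¬ Touch b u
    middle⇒final {t} {a} {b} {c} l<t a∈ b∈ c∈ a<b b<c ta tc u t<u tb = go t<u tb (<-wellFounded _)
      where
      go : ∀ {u} → t < u → Touch b u → Acc ℕ._<_ (toℕ u) → _
      go {u} t<u tb (acc rec) = step
        where
        p∉ : ¬ Keys D (p u)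
        p∉ p∈ = ℕₚ.<⇒≱ (ℕₚ.<-trans l<t t<u)
          (subst (λ s → s ≤ D .last) (inverseˡ π) (proj₂ (key⇒time {D = D} p∈)))
        step : _
        step with touch-stair tb (λ { refl → p∉ b∈ })
        ... | s , s<u , tbs , quiet with toℕ t ℕ.<? toℕ s
        ... | yes t<s = go t<s tbs (rec s<u)
        ... | no t≮s with outside-middle {D = D} p∉ a∈ c∈ a<b b<c
        ... | inj₁ bt = ℕₚ.<-irrefl (cong toℕ (proj₁ (quiet a t (Btw⇒Between bt) (ℕₚ.≮⇒≥ t≮s) t<u ta))) a<b
        ... | inj₂ bt = ℕₚ.<-irrefl (cong toℕ (sym (proj₁ (quiet c t (Btw⇒Between bt) (ℕₚ.≮⇒≥ t≮s) t<u tc)))) b<c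

-- The children of a node and their visibility

data Side : Set where
  left right : Side

module Cells {n : ℕ} {π : Permutation′ n} (𝒢 : Process π)
  {m : ℕ} (child : Fin m → Block π)
  (disjoint : ∀ i j → i ≢ j → ∀ t → ¬ (_∈ᵇ_ π t (child i) × _∈ᵇ_ π t (child j))) where

  open Process 𝒢
  open Blocks 𝒢
  open Block

  start end : Fin m → Fin n
  start i = child i .first
  end i   = child i .last

  -- Children occupy disjoint key intervals, so their least keys order them from left to right.
  pos : Fin m → Fin n
  pos i = child i .lo

  _∈ᵏ_ : Fin n → Fin m → Set
  a ∈ᵏ i = Keys (child i) a

  _∈ᵗ_ : Fin n → Fin m → Set
  t ∈ᵗ i = _∈ᵇ_ π t (child i)

  CellTouch : Fin m → Fin n → Set
  CellTouch j t = ∃[ a ] a ∈ᵏ j × Touch a t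

  CellTouch? : ∀ j t → Dec (CellTouch j t)
  CellTouch? j t = any? λ a → Keys? (child j) a ×-dec Touch? a t

  Beside : Side → Fin m → Fin m → Set
  Beside left  k j = pos k < pos j
  Beside right k j = pos j < pos k

  Beside? : ∀ σ k j → Dec (Beside σ k j)
  Beside? left  k j = toℕ (pos k) ℕ.<? toℕ (pos j)
  Beside? right k j = toℕ (pos j) ℕ.<? toℕ (pos k)

  -- Disjointness is given for times; it passes to keys through the access time of `a`.
  same-cell : ∀ {i j a} → a ∈ᵏ i → a ∈ᵏ j → i ≡ j
  same-cell {i} {j} {a} a∈i a∈j with i ≟ j
  ... | yes i≡j = i≡j
  ... | no i≢j  = contradiction (key⇒time {D = child i} a∈i , key⇒time {D = child j} a∈j)
                    (disjoint i j i≢j (time a))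

  same-cell-time : ∀ {i j t} → t ∈ᵗ i → t ∈ᵗ j → i ≡ j
  same-cell-time {i} {j} {t} t∈i t∈j with i ≟ j
  ... | yes i≡j = i≡j
  ... | no i≢j  = contradiction (t∈i , t∈j) (disjoint i j i≢j t)

  pos-injective : ∀ {i j} → toℕ (pos i) ≡ toℕ (pos j) → i ≡ j
  pos-injective {i} {j} eq = same-cell (lo∈ {D = child i})
    (subst (_∈ᵏ j) (sym (toℕ-injective eq)) (lo∈ {D = child j}))

  Beside-compare : ∀ i j → i ≢ j → ∃[ σ ] Beside σ i j
  Beside-compare i j i≢j with ℕₚ.<-cmp (toℕ (pos i)) (toℕ (pos j))
  ... | tri< i<j _ _ = left , i<j
  ... | tri≈ _ i≡j _ = contradiction (pos-injective i≡j) i≢j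
  ... | tri> _ _ j<i = right , j<i

  cell-< : ∀ {i j a b} → pos i < pos j → a ∈ᵏ i → b ∈ᵏ j → a < b
  cell-< {i} {j} i<j a∈ b∈ = ℕₚ.≰⇒> λ b≤a → ℕₚ.<-irrefl (cong (toℕ ∘ pos)
    (same-cell {i} {j} {pos j} (ℕₚ.<⇒≤ i<j , ℕₚ.≤-trans (proj₁ b∈) (ℕₚ.≤-trans b≤a (proj₂ a∈)))
      (lo∈ {D = child j}))) i<j

  cell-Btw : ∀ {i k j a w b} → Btw (pos i) (pos k) (pos j) → a ∈ᵏ i → w ∈ᵏ k → b ∈ᵏ j → Btw a w b
  cell-Btw (inj₁ (i<k , k<j)) a∈ w∈ b∈ = inj₁ (cell-< i<k a∈ w∈ , cell-< k<j w∈ b∈)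
  cell-Btw (inj₂ (j<k , k<i)) a∈ w∈ b∈ = inj₂ (cell-< j<k b∈ w∈ , cell-< k<i w∈ a∈)

  Near : Fin m → Side → Fin m → Set
  Near i σ j = start j < start i × Beside σ j i ×
               (∀ k → start k < start i → ¬ Btw (pos i) (pos k) (pos j))

  -- A child `k` begun before `i` and lying in between contributes the key accessed at its start,
  -- and `shielded` forbids any touch beyond that key.
  late-touch⇒Near : ∀ {i j s} → s ∈ᵗ i → start i < s → CellTouch j s → j ≢ i → ∃[ σ ] Near i σ j
  late-touch⇒Near {i} {j} {s} s∈ i<s (a , a∈ , ta) j≢i with Beside-compare j i j≢i
  ... | σ , beside = σ ,
      ℕₚ.≤-<-trans (proj₁ (key⇒time {D = child j} a∈))
        (foreign⇒earlier {D = child i} s∈ ta (λ a∈i → j≢i (same-cell a∈ a∈i))) ,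
      beside , λ k k<i btw → shielded {D = child i} s∈ i<s ta
        (λ w∈i → ℕₚ.<-irrefl (cong (toℕ ∘ start) (same-cell (time⇒key {D = child k} (first∈ (child k))) w∈i)) k<i)
        (subst (λ t → t < start i) (sym (inverseˡ π)) k<i)
        (cell-Btw btw (time⇒key {D = child i} s∈) (time⇒key {D = child k} (first∈ (child k))) a∈)

  Near-unique : ∀ i σ j j′ → Near i σ j → Near i σ j′ → j ≡ j′
  Near-unique i left j j′ (e , b , none) (e′ , b′ , none′) with ℕₚ.<-cmp (toℕ (pos j)) (toℕ (pos j′))
  ... | tri< j<j′ _ _ = contradiction (inj₂ (j<j′ , b′)) (none j′ e′)
  ... | tri≈ _ eq _   = pos-injective eq
  ... | tri> _ _ j′<j = contradiction (inj₂ (j′<j , b)) (none′ j e)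
  Near-unique i right j j′ (e , b , none) (e′ , b′ , none′) with ℕₚ.<-cmp (toℕ (pos j)) (toℕ (pos j′))
  ... | tri< j<j′ _ _ = contradiction (inj₁ (b , j<j′)) (none′ j e)
  ... | tri≈ _ eq _   = pos-injective eq
  ... | tri> _ _ j′<j = contradiction (inj₁ (b′ , j′<j)) (none j′ e′)

  -- Visibility as a potential for one level of halving

  module Grouped (g : Fin m → ℕ) (g-mono : ∀ i j → pos i < pos j → g i ℕ.≤ g j) where

    -- The bound `b` is a natural number because the moment after the last time does not exist in
    -- `Fin n`.
    VisibleFrom : Side → Fin m → ℕ → Set
    VisibleFrom σ j b = ∃[ s ] toℕ s ℕ.< b × CellTouch j s ×
      (∀ k → g k ≡ g j → Beside σ k j → ∀ s′ → s ≤ s′ → toℕ s′ ℕ.< b → ¬ CellTouch k s′)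

    Visible : Fin m → ℕ → Set
    Visible j b = ∃[ σ ] VisibleFrom σ j b

    VisibleFrom? : ∀ σ j b → Dec (VisibleFrom σ j b)
    VisibleFrom? σ j b = any? λ s → (toℕ s ℕ.<? b) ×-dec CellTouch? j s ×-dec
      all? λ k → (g k ℕ.≟ g j) →-dec (Beside? σ k j →-dec
        all? λ s′ → (toℕ s ℕ.≤? toℕ s′) →-dec ((toℕ s′ ℕ.<? b) →-dec ¬? (CellTouch? k s′)))

    Visible? : ∀ j b → Dec (Visible j b)
    Visible? j b with VisibleFrom? left j b | VisibleFrom? right j b
    ... | yes v | _     = yes (left , v)
    ... | no _  | yes v = yes (right , v)
    ... | no ¬l | no ¬r = no λ { (left , v) → ¬l v ; (right , v) → ¬r v }

    -- As `g` is monotone, groups are contiguous in key order, so `i` sees the whole group of `j`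
    -- from one side.
    facing-side : ∀ {i j} → g j ≢ g i →
                  ∃[ σ ] (∀ k → g k ≡ g j → Beside σ k j → Btw (pos i) (pos k) (pos j))
    facing-side {i} {j} gj≢gi with Beside-compare i j (gj≢gi ∘ cong g ∘ sym)
    ... | left , i<j = left , λ k gk≡gj k<j → inj₁ (between k gk≡gj , k<j)
      where
      between : ∀ k → g k ≡ g j → pos i < pos k
      between k gk≡gj with ℕₚ.<-cmp (toℕ (pos i)) (toℕ (pos k))
      ... | tri< i<k _ _ = i<k
      ... | tri≈ _ eq _  = contradiction (trans (sym gk≡gj) (cong g (sym (pos-injective eq)))) gj≢gi
      ... | tri> _ _ k<i = contradiction
        (ℕₚ.≤-antisym (ℕₚ.≤-trans (ℕₚ.≤-reflexive (sym gk≡gj)) (g-mono k i k<i)) (g-mono i j i<j)) gj≢gi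
    ... | right , j<i = right , λ k gk≡gj j<k → inj₂ (j<k , between k gk≡gj)
      where
      between : ∀ k → g k ≡ g j → pos k < pos i
      between k gk≡gj with ℕₚ.<-cmp (toℕ (pos k)) (toℕ (pos i))
      ... | tri< k<i _ _ = k<i
      ... | tri≈ _ eq _  = contradiction (trans (sym gk≡gj) (cong g (pos-injective eq))) gj≢gi
      ... | tri> _ _ i<k = contradiction
        (ℕₚ.≤-antisym (g-mono j i j<i) (ℕₚ.≤-trans (g-mono i k i<k) (ℕₚ.≤-reflexive gk≡gj))) gj≢gi

    -- The stair to the touched key has an empty rectangle, and the members of the group on the
    -- facing side of `j` have all their keys within its range.
    touched⇒visible : ∀ {i j t} → t ∈ᵗ i → g j ≢ g i → CellTouch j t → Visible j (toℕ t)
    touched⇒visible {i} {j} {t} t∈ gj≢gi (a , a∈ , ta) with facing-side gj≢gi | touch-stair ta a≢p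
      where
      a≢p : a ≢ p t
      a≢p refl = gj≢gi (cong g (same-cell a∈ (time⇒key {D = child i} t∈)))
    ... | σ , facing | s , s<t , ts , quiet = σ , s , s<t , (a , a∈ , ts) ,
      λ { k gk≡gj beside s′ s≤s′ s′<t (w , w∈ , tw) →
        let btw = cell-Btw (facing k gk≡gj beside) (time⇒key {D = child i} t∈) w∈ a∈
        in Btw-irrefl (subst (Btw (p t) w) (sym (proj₁ (quiet w s′ (Btw⇒Between btw) s≤s′ s′<t tw))) btw) }

    finish : Fin m → ℕ
    finish i = suc (toℕ (end i))

    -- A witness inside the stage of `i` is itself a touch across groups, so `j` was visible when it
    -- occurred; descent on `b` leads back to the start. Hence a stage makes no child of a foreign
    -- group newly visible.
    visible-backwards : ∀ {i j} → g j ≢ g i → ∀ b → toℕ (start i) ℕ.≤ b → b ℕ.≤ finish i →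
                        Visible j b → Visible j (toℕ (start i))
    visible-backwards {i} {j} gj≢gi b f≤b b≤e v = go b f≤b b≤e v (<-wellFounded b)
      where
      go : ∀ b → toℕ (start i) ℕ.≤ b → b ℕ.≤ finish i → Visible j b → Acc ℕ._<_ b →
           Visible j (toℕ (start i))
      go b f≤b b≤e (σ , s , s<b , ts , quiet) (acc rec) with toℕ s ℕ.<? toℕ (start i)
      ... | yes s<f = σ , s , s<f , ts , λ k e bs s′ s≤s′ s′<f → quiet k e bs s′ s≤s′ (ℕₚ.<-≤-trans s′<f f≤b)
      ... | no s≮f  = go (toℕ s) f≤s (ℕₚ.≤-trans (ℕₚ.<⇒≤ s<b) b≤e)
                        (touched⇒visible (f≤s , ℕₚ.≤-pred (ℕₚ.≤-trans s<b b≤e)) gj≢gi ts) (rec s<b)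
        where f≤s = ℕₚ.≮⇒≥ s≮f

    -- Equal halved labels: j lies in the sibling of the group of i.
    Cost : Fin m → Fin m → Set
    Cost i j = g j ≢ g i × ⌊ g j /2⌋ ≡ ⌊ g i /2⌋ × CellTouch j (start i)

    Cost? : ∀ i j → Dec (Cost i j)
    Cost? i j = ¬? (g j ℕ.≟ g i) ×-dec (⌊ g j /2⌋ ℕ.≟ ⌊ g i /2⌋) ×-dec CellTouch? j (start i)

    Extreme : Fin m → Side → Fin m → Set
    Extreme i σ j = CellTouch j (start i) ×
      (∀ k → g k ≡ g j → Beside σ k j → ¬ CellTouch k (start i))

    Extreme-unique : ∀ i σ j j′ → g j ≡ g j′ → Extreme i σ j → Extreme i σ j′ → j ≡ j′
    Extreme-unique i σ j j′ eq (tj , ext) (tj′ , ext′) with j ≟ j′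
    ... | yes j≡j′ = j≡j′
    ... | no j≢j′ with σ | Beside-compare j j′ j≢j′
    ... | left  | left  , b = contradiction tj (ext′ j eq b)
    ... | left  | right , b = contradiction tj′ (ext j′ (sym eq) b)
    ... | right | left  , b = contradiction tj′ (ext j′ (sym eq) b)
    ... | right | right , b = contradiction tj (ext′ j eq b)

    -- The children on which cost plus visibility after the stage exceeds visibility before it.
    Surplus : Fin m → Fin m → Set
    Surplus i j = Visible j (finish i) × (Cost i j ⊎ ¬ Visible j (toℕ (start i)))

    Surplus? : ∀ i j → Dec (Surplus i j)
    Surplus? i j = Visible? j (finish i) ×-dec (Cost? i j ⊎-dec ¬? (Visible? j (toℕ (start i))))

    Own Sibling : Fin m → Side → Fin m → Set
    Own i σ j     = g j ≡ g i × Extreme i σ j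
    Sibling i σ j = g j ≢ g i × ⌊ g j /2⌋ ≡ ⌊ g i /2⌋ × Extreme i σ j

    -- The seven places for a surplus child: `i` itself, its nearest earlier neighbours, and the
    -- extremes touched at its start in its own and in the sibling group.
    Colour : Fin m → Fin 7 → Fin m → Set
    Colour i 0F j = j ≡ i
    Colour i 1F   = Near i left
    Colour i 2F   = Near i right
    Colour i 3F   = Own i left
    Colour i 4F   = Own i right
    Colour i 5F   = Sibling i left
    Colour i 6F   = Sibling i right

    Colour-unique : ∀ i c j j′ → Colour i c j → Colour i c j′ → j ≡ j′
    Colour-unique i 0F j j′ refl refl = refl
    Colour-unique i 1F = Near-unique i left
    Colour-unique i 2F = Near-unique i right
    Colour-unique i 3F j j′ (e , x) (e′ , x′) = Extreme-unique i left j j′ (trans e (sym e′)) x x′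
    Colour-unique i 4F j j′ (e , x) (e′ , x′) = Extreme-unique i right j j′ (trans e (sym e′)) x x′
    Colour-unique i 5F j j′ (d , e , x) (d′ , e′ , x′) =
      Extreme-unique i left j j′ (⌊/2⌋-pigeonhole (g j) (g j′) (g i) e e′ d d′) x x′
    Colour-unique i 6F j j′ (d , e , x) (d′ , e′ , x′) =
      Extreme-unique i right j j′ (⌊/2⌋-pigeonhole (g j) (g j′) (g i) e e′ d d′) x x′

    near-colour : ∀ {i j} → ∃[ σ ] Near i σ j → ∃[ c ] Colour i c j
    near-colour (left  , x) = 1F , x
    near-colour (right , x) = 2F , x

    own-colour : ∀ {i j} σ → Own i σ j → ∃[ c ] Colour i c j
    own-colour left  x = 3F , x
    own-colour right x = 4F , x

    sibling-colour : ∀ {i j} σ → Sibling i σ j → ∃[ c ] Colour i c j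
    sibling-colour left  x = 5F , x
    sibling-colour right x = 6F , x

    -- Compare the witness `s` of visibility with the start of the stage. If it is older, `j` must
    -- have been charged and is extreme in the sibling group. If it is the start itself, `j` is
    -- extreme in its own or the sibling group. If it is later, only `i` and its neighbours remain.
    surplus-colour : ∀ i j → Surplus i j → ∃[ c ] Colour i c j
    surplus-colour i j ((σ , s , s<e , ts , quiet) , new) with ℕₚ.<-cmp (toℕ s) (toℕ (start i))
    surplus-colour i j ((σ , s , s<e , ts , quiet) , inj₂ ¬v) | tri< s<f _ _ =
      contradiction (σ , s , s<f , ts , λ k e b s′ s≤s′ s′<f →
        quiet k e b s′ s≤s′ (ℕₚ.<-trans s′<f (s≤s (child i .first≤last)))) ¬v
    surplus-colour i j ((σ , s , s<e , ts , quiet) , inj₁ (d , e , tf)) | tri< s<f _ _ =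
      sibling-colour σ (d , e , tf , λ k eq b → quiet k eq b (start i) (ℕₚ.<⇒≤ s<f) (s≤s (child i .first≤last)))
    surplus-colour i j (v@(σ , s , s<e , ts , quiet) , new) | tri≈ _ s≡f _
      with toℕ-injective s≡f
    ... | refl = [ (λ (d , e , _) → sibling-colour σ (d , e , extreme)) , own ]′ new
      where
      extreme : Extreme i σ j
      extreme = ts , λ k eq b → quiet k eq b s ℕₚ.≤-refl s<e
      own : ¬ Visible j (toℕ (start i)) → ∃[ c ] Colour i c j
      own ¬v with g j ℕ.≟ g i
      ... | yes eq = own-colour σ (eq , extreme)
      ... | no d   = contradiction
        (visible-backwards d (finish i) (ℕₚ.m≤n⇒m≤1+n (child i .first≤last)) ℕₚ.≤-refl v) ¬v
    surplus-colour i j ((σ , s , s<e , ts , quiet) , new) | tri> _ _ f<s with j ≟ i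
    ... | yes j≡i = 0F , j≡i
    ... | no j≢i  = near-colour (late-touch⇒Near (ℕₚ.<⇒≤ f<s , ℕₚ.≤-pred s<e) f<s ts j≢i)

    visibility : ℕ → ℕ
    visibility b = ∑[ j < m ] ind (Visible? j b)

    cost : Fin m → ℕ
    cost i = ∑[ j < m ] ind (Cost? i j)

    -- A charged `j` was visible when the stage began, by `touched⇒visible`; losing that visibility
    -- pays for the charge.
    cost-cell : ∀ i j → ind (Cost? i j) + ind (Visible? j (finish i))
                        ℕ.≤ ind (Visible? j (toℕ (start i))) + ind (Surplus? i j)
    cost-cell i j = by-cases (Cost? i j) (Visible? j (finish i)) (Visible? j (toℕ (start i))) (Surplus? i j)
      where
      by-cases : (C : Dec (Cost i j)) (E : Dec (Visible j (finish i)))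
                 (S : Dec (Visible j (toℕ (start i)))) (R : Dec (Surplus i j)) →
                 ind C + ind E ℕ.≤ ind S + ind R
      by-cases (no _)  (no _)  _       _       = z≤n
      by-cases (no _)  (yes _) (yes _) _       = s≤s z≤n
      by-cases (no _)  (yes _) (no _)  (yes _) = ℕₚ.≤-refl
      by-cases (no _)  (yes v) (no ¬v) (no ¬r) = contradiction (v , inj₂ ¬v) ¬r
      by-cases (yes _) (no _)  (yes _) _       = s≤s z≤n
      by-cases (yes _) (yes _) (yes _) (yes _) = ℕₚ.≤-refl
      by-cases (yes c) (yes v) (yes _) (no ¬r) = contradiction (v , inj₁ c) ¬r
      by-cases (yes (d , _ , tf)) _ (no ¬v) _  =
        contradiction (touched⇒visible (first∈ (child i)) d tf) ¬v

    stage : ∀ i → cost i + visibility (finish i) ℕ.≤ visibility (toℕ (start i)) + 7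
    stage i = begin
      cost i + visibility (finish i)
        ≡⟨ ∑-distrib-+ (λ j → ind (Cost? i j)) (λ j → ind (Visible? j (finish i))) ⟨
      ∑[ j < m ] (ind (Cost? i j) + ind (Visible? j (finish i)))
        ≤⟨ sum-mono (cost-cell i) ⟩
      ∑[ j < m ] (ind (Visible? j (toℕ (start i))) + ind (Surplus? i j))
        ≡⟨ ∑-distrib-+ (λ j → ind (Visible? j (toℕ (start i)))) (λ j → ind (Surplus? i j)) ⟩
      visibility (toℕ (start i)) + ∑[ j < m ] ind (Surplus? i j)
        ≤⟨ ℕₚ.+-monoʳ-≤ (visibility (toℕ (start i)))
             (count≤colours (Surplus? i) (Colour i) (surplus-colour i) (Colour-unique i)) ⟩
      visibility (toℕ (start i)) + 7 ∎
      where open ℕₚ.≤-Reasoning hiding (start)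

-- Amortization over the children of a node

module Partition {n : ℕ} {π : Permutation′ n} (𝒢 : Process π) (B : Block π)
  {m : ℕ} (child : Fin m → Block π)
  (disjoint : ∀ i j → i ≢ j → ∀ t → ¬ (_∈ᵇ_ π t (child i) × _∈ᵇ_ π t (child j)))
  (cover : ∀ t → _∈ᵇ_ π t B ⇔ (∃[ i ] _∈ᵇ_ π t (child i))) where

  open Process 𝒢
  open Blocks 𝒢
  open Cells 𝒢 child disjoint
  open Block

  child⊆ : ∀ {t} i → t ∈ᵗ i → _∈ᵇ_ π t B
  child⊆ i t∈ = Equivalence.from (cover _) (i , t∈)

  -- A prefix sum in time order: children are indexed in an arbitrary order, so the finished ones
  -- are selected by an indicator.
  weighted : ℕ → (Fin m → ℕ) → ℕ
  weighted b f = ∑[ i < m ] (ind (toℕ (end i) ℕ.<? b) * f i)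

  weighted-finish : ∀ i f → weighted (suc (toℕ (end i))) f ≡ weighted (toℕ (start i)) f + f i
  weighted-finish i f = begin
    weighted (suc (toℕ (end i))) f
      ≡⟨ sum-cong-≗ (λ k → trans (cong (_* f k) (split k)) (ℕₚ.*-distribʳ-+ (f k) (earlier k) _)) ⟩
    ∑[ k < m ] (earlier k * f k + ind (k ≟ i) * f k)
      ≡⟨ ∑-distrib-+ (λ k → earlier k * f k) (λ k → ind (k ≟ i) * f k) ⟩
    weighted (toℕ (start i)) f + ∑[ k < m ] (ind (k ≟ i) * f k)
      ≡⟨ cong (weighted (toℕ (start i)) f +_) (sum-delta f i) ⟩
    weighted (toℕ (start i)) f + f i ∎
    where
    open ≡-Reasoning
    earlier : Fin m → ℕ
    earlier k = ind (toℕ (end k) ℕ.<? toℕ (start i))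
    split : ∀ k → ind (toℕ (end k) ℕ.<? suc (toℕ (end i))) ≡ earlier k + ind (k ≟ i)
    split k with toℕ (end k) ℕ.<? suc (toℕ (end i)) | toℕ (end k) ℕ.<? toℕ (start i) | k ≟ i
    ... | yes _   | yes _   | no _     = refl
    ... | yes _   | no _    | yes _    = refl
    ... | no _    | no _    | no _     = refl
    ... | _       | yes k<i | yes refl = contradiction (child i .first≤last) (ℕₚ.<⇒≱ k<i)
    ... | no k≮i  | _       | yes refl = contradiction (ℕₚ.n<1+n _) k≮i
    ... | no k≮i  | yes k<i | no _     = contradiction (ℕₚ.<-trans k<i (s≤s (child i .first≤last))) k≮i
    ... | yes k≤i | no k≮i  | no k≢i   =
      contradiction (same-cell-time (last∈ (child k)) (ℕₚ.≮⇒≥ k≮i , ℕₚ.≤-pred k≤i)) k≢i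

  Boundary : ℕ → Set
  Boundary b = ∀ i → toℕ (end i) ℕ.< b ⊎ b ℕ.≤ toℕ (start i)

  start-boundary : ∀ i → Boundary (toℕ (start i))
  start-boundary i k with toℕ (end k) ℕ.<? toℕ (start i)
  ... | yes k<i = inj₁ k<i
  ... | no k≮i  = inj₂ (ℕₚ.≮⇒≥ λ k<i → ℕₚ.<-irrefl
    (cong (toℕ ∘ start) (same-cell-time {k} {i} (ℕₚ.<⇒≤ k<i , ℕₚ.≮⇒≥ k≮i) (first∈ (child i)))) k<i)

  -- The time just before `b` lies in some child, and as `b` cuts through no child, that child ends
  -- there.
  boundary⇒finish : ∀ b → Boundary b → toℕ (B .first) ℕ.< b → b ℕ.≤ suc (toℕ (B .last)) →
                    ∃[ i ] b ≡ suc (toℕ (end i))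
  boundary⇒finish (suc b) cut f<b b≤l with Equivalence.to (cover t)
      (subst (toℕ (B .first) ℕ.≤_) (sym t≡b) (ℕₚ.≤-pred f<b) , subst (ℕ._≤ toℕ (B .last)) (sym t≡b) (ℕₚ.≤-pred b≤l))
    where
    b<n = ℕₚ.≤-<-trans (ℕₚ.≤-pred b≤l) (toℕ<n (B .last))
    t = fromℕ< b<n
    t≡b : toℕ t ≡ b
    t≡b = toℕ-fromℕ< b<n
  ... | i , f≤t , t≤l with cut i
  ... | inj₁ e<b = i , cong suc (ℕₚ.≤-antisym (subst (ℕ._≤ toℕ (end i)) (toℕ-fromℕ< _) t≤l) (ℕₚ.≤-pred e<b))
  ... | inj₂ b≤f = contradiction (subst (toℕ (start i) ℕ.≤_) (toℕ-fromℕ< _) f≤t) (ℕₚ.<⇒≱ b≤f)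

  module _ (g : Fin m → ℕ) (g-mono : ∀ i j → pos i < pos j → g i ℕ.≤ g j) where
    open Grouped g g-mono

    -- Induction backwards over the stages: a boundary after the first time of `B` closes some
    -- child, whose `stage` inequality is added to the bound at its start. At the first time of `B`
    -- none of its keys has been touched, so the potential is zero.
    amortized : ∀ b → toℕ (B .first) ℕ.≤ b → b ℕ.≤ suc (toℕ (B .last)) → Boundary b → Acc ℕ._<_ b →
                weighted b cost + visibility b ℕ.≤ weighted b (const 7)
    amortized b f≤b b≤l cut (acc rec) with toℕ (B .first) ℕ.≟ b
    ... | yes refl = ℕₚ.≤-trans (ℕₚ.≤-reflexive (cong₂ _+_ (sum-zero no-cost) (sum-zero unseen))) z≤n
      where
      no-cost : ∀ i → ind (toℕ (end i) ℕ.<? toℕ (B .first)) * cost i ≡ 0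
      no-cost i = cong (_* cost i)
        (ind-no (toℕ (end i) ℕ.<? toℕ (B .first)) (ℕₚ.≤⇒≯ (proj₁ (child⊆ i (last∈ (child i))))))
      unseen : ∀ j → ind (Visible? j (toℕ (B .first))) ≡ 0
      unseen j = ind-no (Visible? j (toℕ (B .first))) λ (_ , s , s<f , (a , a∈ , ta) , _) →
        untouched-before {D = child j} a∈ (ℕₚ.<-≤-trans s<f (proj₁ (child⊆ j (first∈ (child j))))) ta
    ... | no f≢b with boundary⇒finish b cut (ℕₚ.≤∧≢⇒< f≤b f≢b) b≤l
    ... | i , refl = begin
      weighted (finish i) cost + visibility (finish i)
        ≡⟨ cong (_+ visibility (finish i)) (weighted-finish i cost) ⟩
      (W + cost i) + visibility (finish i)
        ≡⟨ ℕₚ.+-assoc W (cost i) _ ⟩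
      W + (cost i + visibility (finish i))
        ≤⟨ ℕₚ.+-monoʳ-≤ W (stage i) ⟩
      W + (visibility (toℕ (start i)) + 7)
        ≡⟨ ℕₚ.+-assoc W _ 7 ⟨
      (W + visibility (toℕ (start i))) + 7
        ≤⟨ ℕₚ.+-monoˡ-≤ 7 (amortized (toℕ (start i)) (proj₁ (child⊆ i (first∈ (child i))))
             (ℕₚ.m≤n⇒m≤1+n (proj₂ (child⊆ i (first∈ (child i))))) (start-boundary i)
             (rec (s≤s (child i .first≤last)))) ⟩
      weighted (toℕ (start i)) (const 7) + 7
        ≡⟨ weighted-finish i (const 7) ⟨
      weighted (finish i) (const 7) ∎
      where
      open ℕₚ.≤-Reasoning hiding (start)
      W = weighted (toℕ (start i)) cost

    total-cost : ∑[ i < m ] cost i ℕ.≤ m * 7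
    total-cost = begin
      ∑[ i < m ] cost i                  ≤⟨ sum-mono (λ i → ℕₚ.≤-trans (ℕₚ.≤-reflexive (sym (ℕₚ.*-identityˡ (cost i))))
                                              (ℕₚ.*-monoˡ-≤ (cost i) (ind-yes (toℕ (end i) ℕ.<? b) (end<b i)))) ⟩
      weighted b cost                    ≤⟨ ℕₚ.m≤m+n _ _ ⟩
      weighted b cost + visibility b     ≤⟨ amortized b (ℕₚ.m≤n⇒m≤1+n (B .first≤last)) ℕₚ.≤-refl
                                              (inj₁ ∘ end<b) (<-wellFounded b) ⟩
      weighted b (const 7)               ≤⟨ sum-≤-const 7 (λ i → ind*≤ (toℕ (end i) ℕ.<? b) 7) ⟩
      m * 7                              ∎
      where
      open ℕₚ.≤-Reasoning hiding (start)
      b = suc (toℕ (B .last))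
      end<b : ∀ i → toℕ (end i) ℕ.< b
      end<b i = s≤s (proj₂ (child⊆ i (last∈ (child i))))
      ind*≤ : ∀ {P : Set} (P? : Dec P) x → ind P? * x ℕ.≤ x
      ind*≤ (yes _) x = ℕₚ.≤-reflexive (ℕₚ.*-identityˡ x)
      ind*≤ (no _)  x = z≤n

  Crossing? : ∀ (g : Fin m → ℕ) i j → Dec (g j ≢ g i × CellTouch j (start i))
  Crossing? g i j = ¬? (g j ℕ.≟ g i) ×-dec CellTouch? j (start i)

  crossings : (Fin m → ℕ) → ℕ
  crossings g = ∑[ i < m ] ∑[ j < m ] ind (Crossing? g i j)

  -- Two children with different labels either agree after one halving, and are then paid by `cost`
  -- at this level, or still cross for the halved labels. Labels below `2 ^ L` all become zero after
  -- `L` halvings.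
  crossings-bound : ∀ L (g : Fin m → ℕ) → (∀ i j → pos i < pos j → g i ℕ.≤ g j) →
                    (∀ i → g i ℕ.< 2 ^ L) → crossings g ℕ.≤ L * (m * 7)
  crossings-bound zero g _ g<1 = ℕₚ.≤-reflexive (sum-zero λ i → sum-zero λ j →
    ind-no (Crossing? g i j) λ (gj≢gi , _) → gj≢gi (trans (ℕₚ.n<1⇒n≡0 (g<1 j)) (sym (ℕₚ.n<1⇒n≡0 (g<1 i)))))
  crossings-bound (suc L) g g-mono g<2^ = begin
    crossings g
      ≤⟨ sum-mono (λ i → sum-mono λ j → ind-⊎ (Crossing? g i j) (Cost? i j) (Crossing? half i j) (split i j)) ⟩
    ∑[ i < m ] ∑[ j < m ] (ind (Cost? i j) + ind (Crossing? half i j))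
      ≡⟨ sum-cong-≗ (λ i → ∑-distrib-+ (λ j → ind (Cost? i j)) (λ j → ind (Crossing? half i j))) ⟩
    ∑[ i < m ] (cost i + ∑[ j < m ] ind (Crossing? half i j))
      ≡⟨ ∑-distrib-+ cost (λ i → ∑[ j < m ] ind (Crossing? half i j)) ⟩
    ∑[ i < m ] cost i + crossings half
      ≤⟨ ℕₚ.+-mono-≤ (total-cost g g-mono)
           (crossings-bound L half (λ i j i<j → ℕₚ.⌊n/2⌋-mono (g-mono i j i<j))
             (λ i → ⌊/2⌋-< (g i) (2 ^ L) (g<2^ i))) ⟩
    m * 7 + L * (m * 7) ∎
    where
    open ℕₚ.≤-Reasoning hiding (start)
    open Grouped g g-mono
    half : Fin m → ℕ
    half i = ⌊ g i /2⌋
    split : ∀ i j → g j ≢ g i × CellTouch j (start i) →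
            Cost i j ⊎ (half j ≢ half i × CellTouch j (start i))
    split i j (d , tj) with half j ℕ.≟ half i
    ... | yes e = inj₁ (d , e , tj)
    ... | no d′ = inj₂ (d′ , tj)

  rank : Fin m → ℕ
  rank j = ∑[ k < m ] ind (toℕ (pos k) ℕ.<? toℕ (pos j))

  rank-< : ∀ i j → pos i < pos j → rank i ℕ.< rank j
  rank-< i j i<j = sum-mono-<
    (λ k → ind-mono (toℕ (pos k) ℕ.<? toℕ (pos i)) (toℕ (pos k) ℕ.<? toℕ (pos j)) λ k<i → ℕₚ.<-trans k<i i<j)
    i (subst (ℕ._< ind (toℕ (pos i) ℕ.<? toℕ (pos j)))
         (sym (ind-no (toℕ (pos i) ℕ.<? toℕ (pos i)) (ℕₚ.<-irrefl refl)))
         (ind-yes (toℕ (pos i) ℕ.<? toℕ (pos j)) i<j))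

  rank<m : ∀ i → rank i ℕ.< m
  rank<m i = subst (rank i ℕ.<_) (trans (sum-const m 1) (ℕₚ.*-identityʳ m))
    (sum-mono-< (λ k → ind≤1 (toℕ (pos k) ℕ.<? toℕ (pos i)))
       i (ℕₚ.≤-reflexive (cong suc (ind-no (toℕ (pos i) ℕ.<? toℕ (pos i)) (ℕₚ.<-irrefl refl)))))

  rank-injective : ∀ {i j} → rank i ≡ rank j → i ≡ j
  rank-injective {i} {j} eq with ℕₚ.<-cmp (toℕ (pos i)) (toℕ (pos j))
  ... | tri< i<j _ _ = contradiction eq (ℕₚ.<⇒≢ (rank-< i j i<j))
  ... | tri≈ _ e _   = pos-injective e
  ... | tri> _ _ j<i = contradiction (sym eq) (ℕₚ.<⇒≢ (rank-< j i j<i))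

  -- The factor `m ∸ 1` is what telescopes over the tree. A lone child has no crossing pair;
  -- otherwise `m` is at most twice `m ∸ 1`, which turns 7 into 14.
  rank-crossings : ∀ L → m ℕ.≤ 2 ^ L → crossings rank ℕ.≤ (m ℕ.∸ 1) * (14 * L)
  rank-crossings L m≤2^L with m ℕ.≟ 1
  ... | yes refl = ℕₚ.≤-reflexive (sum-zero λ i → sum-zero λ j →
    ind-no (Crossing? rank i j) λ (d , _) → d (cong rank (only j i)))
    where
    only : (i j : Fin 1) → i ≡ j
    only zero zero = refl
  ... | no m≢1 = ℕₚ.≤-trans
      (crossings-bound L rank (λ i j i<j → ℕₚ.<⇒≤ (rank-< i j i<j)) (λ i → ℕₚ.<-≤-trans (rank<m i) m≤2^L))
      (ℕₚ.≤-trans (ℕₚ.≤-reflexive (ℕₚ.*-comm L (m * 7)))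
        (ℕₚ.≤-trans (ℕₚ.*-monoˡ-≤ L (double m m≢1)) (ℕₚ.≤-reflexive (ℕₚ.*-assoc (m ℕ.∸ 1) 14 L))))
    where
    double : ∀ k → k ≢ 1 → k * 7 ℕ.≤ (k ℕ.∸ 1) * 14
    double zero _ = z≤n
    double (suc zero) ≢1 = contradiction refl ≢1
    double (suc (suc k)) _ = ℕₚ.+-monoʳ-≤ 14 (ℕₚ.*-monoʳ-≤ k (ℕₚ.m≤m+n 7 7))

-- Summing over the decomposition tree

module Counting {n : ℕ} {π : Permutation′ n} (𝒢 : Process π) where

  open Process 𝒢
  open Blocks 𝒢
  open Block

  Final Outermost Inner : Fin n → Fin n → Set
  Final a t     = Touch a t × (∀ u → t < u → ¬ Touch a u)
  Outermost a t = Touch a t × (∀ b → Touch b t → ¬ Btw (p t) a b)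
  Inner a t     = Touch a t × ¬ Final a t × ¬ Outermost a t

  Final? : ∀ a t → Dec (Final a t)
  Final? a t = Touch? a t ×-dec all? λ u → (toℕ t ℕ.<? toℕ u) →-dec ¬? (Touch? a u)

  Outermost? : ∀ a t → Dec (Outermost a t)
  Outermost? a t = Touch? a t ×-dec all? λ b → Touch? b t →-dec ¬? (Btw? (p t) a b)

  Inner? : ∀ a t → Dec (Inner a t)
  Inner? a t = Touch? a t ×-dec ¬? (Final? a t) ×-dec ¬? (Outermost? a t)

  count-final : ∀ a → ∑[ t < n ] ind (Final? a t) ℕ.≤ 1
  count-final a = count≤1 (Final? a) λ t u (ta , after-t) (ua , after-u) → unique t u ta ua after-t after-u
    where
    unique : ∀ t u → Touch a t → Touch a u →
             (∀ s → t < s → ¬ Touch a s) → (∀ s → u < s → ¬ Touch a s) → t ≡ u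
    unique t u ta ua after-t after-u with ℕₚ.<-cmp (toℕ t) (toℕ u)
    ... | tri< t<u _ _ = contradiction ua (after-t u t<u)
    ... | tri≈ _ eq _  = toℕ-injective eq
    ... | tri> _ _ u<t = contradiction ta (after-u t u<t)

  -- Besides the accessed key, only the farthest touched key on each side can be outermost.
  count-outermost : ∀ t → ∑[ a < n ] ind (Outermost? a t) ℕ.≤ 3
  count-outermost t = count≤colours (λ a → Outermost? a t) Colour colour unique
    where
    Colour : Fin 3 → Fin n → Set
    Colour 0F a = a ≡ p t
    Colour 1F a = Outermost a t × p t < a
    Colour 2F a = Outermost a t × a < p t
    colour : ∀ a → Outermost a t → ∃[ c ] Colour c a
    colour a o with ℕₚ.<-cmp (toℕ a) (toℕ (p t))
    ... | tri< a<p _ _ = 2F , o , a<p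
    ... | tri≈ _ eq _  = 0F , toℕ-injective eq
    ... | tri> _ _ p<a = 1F , o , p<a
    unique : ∀ c a b → Colour c a → Colour c b → a ≡ b
    unique 0F a b refl refl = refl
    unique 1F a b ((ta , oa) , p<a) ((tb , ob) , p<b) with ℕₚ.<-cmp (toℕ a) (toℕ b)
    ... | tri< a<b _ _ = contradiction (inj₁ (p<a , a<b)) (oa b tb)
    ... | tri≈ _ eq _  = toℕ-injective eq
    ... | tri> _ _ b<a = contradiction (inj₁ (p<b , b<a)) (ob a ta)
    unique 2F a b ((ta , oa) , a<p) ((tb , ob) , b<p) with ℕₚ.<-cmp (toℕ a) (toℕ b)
    ... | tri< a<b _ _ = contradiction (inj₂ (a<b , b<p)) (ob a ta)
    ... | tri≈ _ eq _  = toℕ-injective eq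
    ... | tri> _ _ b<a = contradiction (inj₂ (b<a , a<p)) (oa b tb)

  InnerAt : Block π → Block π → Fin n → Fin n → Set
  InnerAt D E t a = _∈ᵇ_ π t D × Keys E a × Inner a t

  InnerAt? : ∀ D E t a → Dec (InnerAt D E t a)
  InnerAt? D E t a = InTime? D t ×-dec Keys? E a ×-dec Inner? a t

  inner : Block π → Block π → ℕ
  inner D E = ∑[ t < n ] ∑[ a < n ] ind (InnerAt? D E t a)

  size : Block π → ℕ
  size B = ∑[ t < n ] ind (InTime? B t)

  -- Inner touches between the children of one node

  module Node (B : Block π) {m : ℕ} (child : Fin m → Block π)
    (disjoint : ∀ i j → i ≢ j → ∀ t → ¬ (_∈ᵇ_ π t (child i) × _∈ᵇ_ π t (child j)))
    (cover : ∀ t → _∈ᵇ_ π t B ⇔ (∃[ i ] _∈ᵇ_ π t (child i))) where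

    open Cells 𝒢 child disjoint
    open Partition 𝒢 B child disjoint cover

    -- After the first time of child `i`, `shielded` makes every touch of a key outside it
    -- outermost.
    inner⇒start : ∀ {i j t a} → i ≢ j → InnerAt (child i) (child j) t a → t ≡ start i
    inner⇒start {i} {j} {t} {a} i≢j (t∈ , a∈ , ta , _ , ¬outermost) with toℕ (start i) ℕ.<? toℕ t
    ... | no f≮t  = toℕ-injective (ℕₚ.≤-antisym (ℕₚ.≮⇒≥ f≮t) (proj₁ t∈))
    ... | yes f<t = contradiction
      (ta , λ b tb → shielded {D = child i} t∈ f<t tb a∉ (foreign⇒earlier {D = child i} t∈ ta a∉)) ¬outermost
      where a∉ = λ a∈i → i≢j (same-cell {i} {j} {a} a∈i a∈)

    -- By `middle⇒final`, a touched key with touched keys of child `j` on both sides is final, so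
    -- only the least and the greatest can be inner.
    inner-cell : ∀ {i j} → i ≢ j →
      ∑[ a < n ] ind (InnerAt? (child i) (child j) (start i) a) ℕ.≤ 2
    inner-cell {i} {j} i≢j = count≤colours (InnerAt? (child i) (child j) (start i)) Colour colour unique
      where
      t = start i
      Colour : Fin 2 → Fin n → Set
      Colour 0F a = (a ∈ᵏ j × Touch a t) × (∀ b → b ∈ᵏ j × b < a → ¬ Touch b t)
      Colour 1F a = (a ∈ᵏ j × Touch a t) × (∀ b → b ∈ᵏ j × a < b → ¬ Touch b t)
      colour : ∀ a → InnerAt (child i) (child j) t a → ∃[ c ] Colour c a
      colour a (t∈ , a∈ , ta , ¬final , _)
        with any? (λ b → Keys? (child j) b ×-dec (toℕ b ℕ.<? toℕ a) ×-dec Touch? b t)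
           | any? (λ b → Keys? (child j) b ×-dec (toℕ a ℕ.<? toℕ b) ×-dec Touch? b t)
      ... | no none | _ = 0F , (a∈ , ta) , λ b (b∈ , b<a) tb → none (b , b∈ , b<a , tb)
      ... | yes _ | no none = 1F , (a∈ , ta) , λ b (b∈ , a<b) tb → none (b , b∈ , a<b , tb)
      ... | yes (b , b∈ , b<a , tb) | yes (c , c∈ , a<c , tc) =
        contradiction (ta , middle⇒final {D = child j} finished b∈ a∈ c∈ b<a a<c tb tc) ¬final
        where
        a-early : time a < t
        a-early = foreign⇒earlier {D = child i} t∈ ta (λ a∈i → i≢j (same-cell {i} {j} {a} a∈i a∈))
        -- Child `j` had begun by the access of `a`, before `t`; were it not over, the first time of
        -- child `i` would lie in it.
        finished : end j < t
        finished = ℕₚ.≰⇒> λ t≤e → i≢j (same-cell-time (first∈ (child i))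
          (ℕₚ.≤-trans (proj₁ (key⇒time {D = child j} a∈)) (ℕₚ.<⇒≤ a-early) , t≤e))
      unique : ∀ c a b → Colour c a → Colour c b → a ≡ b
      unique 0F a b ((a∈ , ta) , least-a) ((b∈ , tb) , least-b) with ℕₚ.<-cmp (toℕ a) (toℕ b)
      ... | tri< a<b _ _ = contradiction ta (least-b a (a∈ , a<b))
      ... | tri≈ _ eq _  = toℕ-injective eq
      ... | tri> _ _ b<a = contradiction tb (least-a b (b∈ , b<a))
      unique 1F a b ((a∈ , ta) , greatest-a) ((b∈ , tb) , greatest-b) with ℕₚ.<-cmp (toℕ a) (toℕ b)
      ... | tri< a<b _ _ = contradiction tb (greatest-a b (b∈ , a<b))
      ... | tri≈ _ eq _  = toℕ-injective eq
      ... | tri> _ _ b<a = contradiction ta (greatest-b a (a∈ , b<a))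

    inner-off-diagonal : ∀ {i j} → i ≢ j →
      inner (child i) (child j) ℕ.≤ 2 * ind (Crossing? rank i j)
    inner-off-diagonal {i} {j} i≢j = ℕₚ.≤-trans (sum-single row (start i) elsewhere) (at-start (Crossing? rank i j))
      where
      row : Fin n → ℕ
      row t = ∑[ a < n ] ind (InnerAt? (child i) (child j) t a)
      elsewhere : ∀ t → t ≢ start i → row t ≡ 0
      elsewhere t t≢ = sum-zero λ a → ind-no (InnerAt? (child i) (child j) t a) (t≢ ∘ inner⇒start i≢j)
      at-start : (C : Dec (rank j ≢ rank i × CellTouch j (start i))) → row (start i) ℕ.≤ 2 * ind C
      at-start (yes _) = inner-cell i≢j
      at-start (no ¬c) = ℕₚ.≤-reflexive (sum-zero λ a → ind-no (InnerAt? (child i) (child j) (start i) a)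
        λ (_ , a∈ , ta , _) → ¬c (i≢j ∘ sym ∘ rank-injective , a , a∈ , ta))

    -- One formula for diagonal and off-diagonal pairs; its indicator lets `sum-delta` collapse the
    -- diagonal.
    inner-pair : ∀ i j → inner (child i) (child j) ℕ.≤
                 ind (j ≟ i) * inner (child i) (child i) + 2 * ind (Crossing? rank i j)
    inner-pair i j with j ≟ i
    ... | yes refl = ℕₚ.≤-trans (ℕₚ.≤-reflexive (sym (ℕₚ.*-identityˡ _))) (ℕₚ.m≤m+n _ _)
    ... | no j≢i   = inner-off-diagonal (j≢i ∘ sym)

    InnerIn : Fin n → Fin n → Fin m → Fin m → Set
    InnerIn t a i j = InnerAt (child i) (child j) t a

    locate : ∀ {t a} → InnerAt B B t a → ∃[ i ] ∃[ j ] InnerIn t a i j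
    locate {t} {a} (t∈ , a∈ , inn) =
      let i , t∈i = Equivalence.to (cover t) t∈
          j , a∈j = Equivalence.to (cover (time a)) (key⇒time {D = B} a∈)
      in i , j , t∈i , subst (_∈ᵏ j) (inverseʳ π) (time⇒key {D = child j} a∈j) , inn

    inner-split : inner B B ℕ.≤ ∑[ i < m ] ∑[ j < m ] inner (child i) (child j)
    inner-split = begin
      inner B B
        ≤⟨ sum-mono (λ t → sum-mono λ a → ℕₚ.≤-trans
             (ind≤sum (InnerAt? B B t a) (λ i → any? (InnerAt?′ t a i)) locate)
             (sum-mono λ i → ind≤sum (any? (InnerAt?′ t a i)) (InnerAt?′ t a i) λ x → x)) ⟩
      ∑[ t < n ] ∑[ a < n ] ∑[ i < m ] ∑[ j < m ] f t a i j
        ≡⟨ sum-cong-≗ (λ t → ∑-comm (λ a i → ∑[ j < m ] f t a i j)) ⟩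
      ∑[ t < n ] ∑[ i < m ] ∑[ a < n ] ∑[ j < m ] f t a i j
        ≡⟨ ∑-comm (λ t i → ∑[ a < n ] ∑[ j < m ] f t a i j) ⟩
      ∑[ i < m ] ∑[ t < n ] ∑[ a < n ] ∑[ j < m ] f t a i j
        ≡⟨ sum-cong-≗ (λ i → sum-cong-≗ λ t → ∑-comm (λ a j → f t a i j)) ⟩
      ∑[ i < m ] ∑[ t < n ] ∑[ j < m ] ∑[ a < n ] f t a i j
        ≡⟨ sum-cong-≗ (λ i → ∑-comm (λ t j → ∑[ a < n ] f t a i j)) ⟩
      ∑[ i < m ] ∑[ j < m ] inner (child i) (child j) ∎
      where
      open ℕₚ.≤-Reasoning hiding (start)
      InnerAt?′ : ∀ t a i j → Dec (InnerIn t a i j)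
      InnerAt?′ t a i j = InnerAt? (child i) (child j) t a
      f : Fin n → Fin n → Fin m → Fin m → ℕ
      f t a i j = ind (InnerAt?′ t a i j)

    inner-node : inner B B ℕ.≤ ∑[ i < m ] inner (child i) (child i) + 2 * crossings rank
    inner-node = begin
      inner B B
        ≤⟨ inner-split ⟩
      ∑[ i < m ] ∑[ j < m ] inner (child i) (child j)
        ≤⟨ sum-mono (λ i → sum-mono (inner-pair i)) ⟩
      ∑[ i < m ] ∑[ j < m ] (ind (j ≟ i) * own i + 2 * cross i j)
        ≡⟨ sum-cong-≗ (λ i → trans (∑-distrib-+ (λ j → ind (j ≟ i) * own i) (λ j → 2 * cross i j))
             (cong₂ _+_ (sum-delta (const (own i)) i) (sum-double (cross i)))) ⟩
      ∑[ i < m ] (own i + 2 * ∑[ j < m ] cross i j)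
        ≡⟨ ∑-distrib-+ own (λ i → 2 * ∑[ j < m ] cross i j) ⟩
      ∑[ i < m ] own i + ∑[ i < m ] (2 * ∑[ j < m ] cross i j)
        ≡⟨ cong (∑[ i < m ] own i +_) (sum-double (λ i → ∑[ j < m ] cross i j)) ⟩
      ∑[ i < m ] own i + 2 * crossings rank ∎
      where
      open ℕₚ.≤-Reasoning hiding (start)
      own : Fin m → ℕ
      own i = inner (child i) (child i)
      cross : Fin m → Fin m → ℕ
      cross i j = ind (Crossing? rank i j)
      sum-double : ∀ {l} (h : Fin l → ℕ) → ∑[ i < l ] (2 * h i) ≡ 2 * sum h
      sum-double h = sym (*-distribˡ-sum 2 h)

    size-node : ∑[ i < m ] size (child i) ℕ.≤ size B
    size-node = ℕₚ.≤-trans (ℕₚ.≤-reflexive (∑-comm (λ i t → ind (InTime? (child i) t)))) (sum-mono at)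
      where
      at : ∀ t → ∑[ i < m ] ind (InTime? (child i) t) ℕ.≤ ind (InTime? B t)
      at t with InTime? B t
      ... | yes _ = count≤1 (λ i → InTime? (child i) t) λ i j → same-cell-time
      ... | no t∉ = ℕₚ.≤-reflexive (sum-zero λ i → ind-no (InTime? (child i) t) (t∉ ∘ child⊆ i))

  -- At the single time of a leaf its single key is the accessed one, which is outermost.
  inner-leaf : ∀ B → B .first ≡ B .last → inner B B ≡ 0
  inner-leaf B f≡l = sum-zero λ t → sum-zero λ a → ind-no (InnerAt? B B t a) λ (t∈ , a∈ , ta , _ , ¬outermost) →
    ¬outermost (ta , λ b _ btw → Btw-irreflˡ (subst (λ c → Btw c a b) (accessed t∈ a∈) btw))
    where
    unique : ∀ {s} → _∈ᵇ_ π s B → s ≡ B .first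
    unique (f≤s , s≤l) = toℕ-injective (ℕₚ.≤-antisym (ℕₚ.≤-trans s≤l (ℕₚ.≤-reflexive (cong toℕ (sym f≡l)))) f≤s)
    accessed : ∀ {t a} → _∈ᵇ_ π t B → Keys B a → p t ≡ a
    accessed t∈ a∈ = trans (cong p (trans (unique t∈) (sym (unique (key⇒time {D = B} a∈))))) (inverseʳ π)
    Btw-irreflˡ : ∀ {u v : Fin n} → ¬ Btw u u v
    Btw-irreflˡ (inj₁ (u<u , _)) = ℕₚ.<-irrefl refl u<u
    Btw-irreflˡ (inj₂ (_ , u<u)) = ℕₚ.<-irrefl refl u<u

  -- The extra `28 * L` on the left strengthens the induction. Each child of a node yields one copy
  -- of it; one copy is passed up and the others pay for the crossings of the node. A crossing pair
  -- carries at most two inner touches, so 28 is twice the 14 of `rank-crossings`.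
  inner-tree : ∀ {k B} L → k ℕ.≤ 2 ^ L → DecompositionTree π k B →
               inner B B + 28 * L ℕ.≤ size B * (28 * L)
  inner-tree {B = B} L k≤2^L (leaf f≡l) = begin
    inner B B + 28 * L   ≡⟨ cong (_+ 28 * L) (inner-leaf B f≡l) ⟩
    28 * L               ≡⟨ ℕₚ.*-identityˡ (28 * L) ⟨
    1 * (28 * L)         ≤⟨ ℕₚ.*-monoˡ-≤ (28 * L) (ℕₚ.≤-trans (ind-yes (InTime? B (B .first)) (first∈ B))
                                                (term≤sum (λ t → ind (InTime? B t)) (B .first))) ⟩
    size B * (28 * L)    ∎
    where open ℕₚ.≤-Reasoning
  -- The first time of `B` lies in some child, so a node without children is impossible.
  inner-tree {B = B} L k≤2^L (node zero _ child disjoint cover trees)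
    with () ← proj₁ (Equivalence.to (cover (B .first)) (first∈ B))
  inner-tree {B = B} L k≤2^L (node (suc m) m≤k child disjoint cover trees) = begin
    inner B B + c
      ≤⟨ ℕₚ.+-monoˡ-≤ c inner-node ⟩
    (sum own + 2 * crossings rank) + c
      ≤⟨ ℕₚ.+-monoˡ-≤ c (ℕₚ.+-monoʳ-≤ (sum own) (ℕₚ.*-monoʳ-≤ 2 (rank-crossings L (ℕₚ.≤-trans m≤k k≤2^L)))) ⟩
    (sum own + 2 * (m * (14 * L))) + c
      ≡⟨ solve 3 (λ s m L → (s :+ con 2 :* (m :* (con 14 :* L))) :+ con 28 :* L :=
                            s :+ (con 28 :* L :+ m :* (con 28 :* L))) refl (sum own) m L ⟩
    sum own + suc m * c
      ≡⟨ cong (sum own +_) (sum-const (suc m) c) ⟨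
    sum own + ∑[ i < suc m ] c
      ≡⟨ ∑-distrib-+ own (const c) ⟨
    ∑[ i < suc m ] (own i + c)
      ≤⟨ sum-mono (λ i → inner-tree L k≤2^L (trees i)) ⟩
    ∑[ i < suc m ] (size (child i) * c)
      ≡⟨ *-distribʳ-sum c (size ∘ child) ⟨
    sum (size ∘ child) * c
      ≤⟨ ℕₚ.*-monoˡ-≤ c size-node ⟩
    size B * c ∎
    where
    open ℕₚ.≤-Reasoning
    open Node B child disjoint cover
    open Partition 𝒢 B child disjoint cover using (crossings; rank; rank-crossings)
    c = 28 * L
    own : Fin (suc m) → ℕ
    own i = inner (child i) (child i)

  touches : ℕ
  touches = ∑[ a < n ] ∑[ t < n ] ind (Touch? a t)

  -- The 4 is one final touch per key plus three outermost touches per time; all others are inner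
  -- and are counted at the root.
  touches-bound : ∀ {k} L → k ℕ.≤ 2 ^ L → Decomposable π k → touches ℕ.≤ n * (4 + 28 * L)
  touches-bound L k≤2^L (B , whole , tree) = begin
    touches
      ≤⟨ sum-mono (λ a → sum-mono (classify a)) ⟩
    ∑[ a < n ] ∑[ t < n ] (ind (Final? a t) + (ind (Outermost? a t) + ind (Inner? a t)))
      ≡⟨ sum-+₂ (λ a t → ind (Final? a t)) (λ a t → ind (Outermost? a t) + ind (Inner? a t)) ⟩
    ∑[ a < n ] ∑[ t < n ] ind (Final? a t) + ∑[ a < n ] ∑[ t < n ] (ind (Outermost? a t) + ind (Inner? a t))
      ≡⟨ cong (∑[ a < n ] ∑[ t < n ] ind (Final? a t) +_)
           (trans (sum-+₂ (λ a t → ind (Outermost? a t)) (λ a t → ind (Inner? a t)))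
             (cong₂ _+_ (∑-comm (λ a t → ind (Outermost? a t))) (∑-comm (λ a t → ind (Inner? a t))))) ⟩
    ∑[ a < n ] ∑[ t < n ] ind (Final? a t)
      + (∑[ t < n ] ∑[ a < n ] ind (Outermost? a t) + ∑[ t < n ] ∑[ a < n ] ind (Inner? a t))
      ≤⟨ ℕₚ.+-mono-≤ (sum-≤-const 1 count-final) (ℕₚ.+-mono-≤ (sum-≤-const 3 count-outermost) inner-total) ⟩
    n * 1 + (n * 3 + n * (28 * L))
      ≡⟨ solve 2 (λ n L → n :* con 1 :+ (n :* con 3 :+ n :* (con 28 :* L)) := n :* (con 4 :+ con 28 :* L))
           refl n L ⟩
    n * (4 + 28 * L) ∎
    where
    open ℕₚ.≤-Reasoning
    sum-+₂ : (f g : Fin n → Fin n → ℕ) → ∑[ a < n ] ∑[ t < n ] (f a t + g a t) ≡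
             ∑[ a < n ] ∑[ t < n ] f a t + ∑[ a < n ] ∑[ t < n ] g a t
    sum-+₂ f g = trans (sum-cong-≗ (λ a → ∑-distrib-+ (f a) (g a))) (∑-distrib-+ (sum ∘ f) (sum ∘ g))
    classify : ∀ a t → ind (Touch? a t) ℕ.≤ ind (Final? a t) + (ind (Outermost? a t) + ind (Inner? a t))
    classify a t = ℕₚ.≤-trans
      (ind-⊎ (Touch? a t) (Final? a t) (Outermost? a t ⊎-dec Inner? a t) cases)
      (ℕₚ.+-monoʳ-≤ (ind (Final? a t))
        (ind-⊎ (Outermost? a t ⊎-dec Inner? a t) (Outermost? a t) (Inner? a t) λ x → x))
      where
      cases : Touch a t → Final a t ⊎ (Outermost a t ⊎ Inner a t)
      cases ta with Final? a t | Outermost? a t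
      ... | yes f | _     = inj₁ f
      ... | no _  | yes o = inj₂ (inj₁ o)
      ... | no ¬f | no ¬o = inj₂ (inj₂ (ta , ¬f , ¬o))
    inner-total : ∑[ t < n ] ∑[ a < n ] ind (Inner? a t) ℕ.≤ n * (28 * L)
    inner-total = begin
      ∑[ t < n ] ∑[ a < n ] ind (Inner? a t)
        ≤⟨ sum-mono (λ t → sum-mono λ a → ind-mono (Inner? a t) (InnerAt? B B t a) λ inn →
             whole t , subst (Keys B) (inverseʳ π) (time⇒key {D = B} (whole (time a))) , inn) ⟩
      inner B B                ≤⟨ ℕₚ.m≤m+n (inner B B) (28 * L) ⟩
      inner B B + 28 * L       ≤⟨ inner-tree L k≤2^L tree ⟩
      size B * (28 * L)        ≤⟨ ℕₚ.*-monoˡ-≤ (28 * L) (ℕₚ.≤-trans (sum-≤-const 1 λ t → ind≤1 (InTime? B t))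
                                                           (ℕₚ.≤-reflexive (ℕₚ.*-identityʳ n))) ⟩
      n * (28 * L)             ∎

-- The bound in exponentiated form

theorem1p1 : ∃[ C ] C > 0 × (∀ (n k : ℕ) → n ≥ 1 → k ≥ 2 →
    (π : Permutation′ n) → Decomposable π k →
    card (X? π ∪? G? π) ≤ C * n ·log₂ k)
-- 60 is 4 + 2 · 28: the 4 is absorbed by `2 ≤ k`, and `2 ^ L ≤ k ^ 2` doubles the 28.
theorem1p1 = 60 , s≤s z≤n , λ n k n≥1 k≥2 π dec →
  let L , k≤2^L , 2^L≤k² = log₂-approx k k≥2
      open Counting (greedy π)
      open ℕₚ.≤-Reasoning
  in begin
    2 ^ card (X? π ∪? G? π)
      ≤⟨ ℕₚ.^-monoʳ-≤ 2 (ℕₚ.≤-trans (ℕₚ.≤-reflexive (card≡sum (X? π ∪? G? π))) (touches-bound L k≤2^L dec)) ⟩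
    2 ^ (n * (4 + 28 * L))
      ≡⟨ cong (2 ^_) (solve 2 (λ n L → n :* (con 4 :+ con 28 :* L) := con 4 :* n :+ L :* (con 28 :* n)) refl n L) ⟩
    2 ^ (4 * n + L * (28 * n))
      ≡⟨ ℕₚ.^-distribˡ-+-* 2 (4 * n) (L * (28 * n)) ⟩
    2 ^ (4 * n) * 2 ^ (L * (28 * n))
      ≡⟨ cong (2 ^ (4 * n) *_) (ℕₚ.^-*-assoc 2 L (28 * n)) ⟨
    2 ^ (4 * n) * (2 ^ L) ^ (28 * n)
      ≤⟨ ℕₚ.*-mono-≤ (ℕₚ.^-monoˡ-≤ (4 * n) k≥2) (ℕₚ.^-monoˡ-≤ (28 * n) 2^L≤k²) ⟩
    k ^ (4 * n) * (k ^ 2) ^ (28 * n)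
      ≡⟨ cong (k ^ (4 * n) *_) (ℕₚ.^-*-assoc k 2 (28 * n)) ⟩
    k ^ (4 * n) * k ^ (2 * (28 * n))
      ≡⟨ ℕₚ.^-distribˡ-+-* k (4 * n) (2 * (28 * n)) ⟨
    k ^ (4 * n + 2 * (28 * n))
      ≡⟨ cong (k ^_) (solve 1 (λ n → con 4 :* n :+ con 2 :* (con 28 :* n) := con 60 :* n) refl n) ⟩
    k ^ (60 * n) ∎
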